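{- Let $G$ be a connected planar cubic bipartite graph and let $e_1,e_2$ be any two edges of $G$. Then there exists a 2-factor of $G$ such that $e_1$ and $e_2$ are contained in the same cycle of the 2-factor.
   Context: Graphs may have multiple edges but no self-loops. A 2-factor is a spanning 2-regular subgraph, i.e., a disjoint union of cycles covering all vertices. -}

module Defs where

open import Data.Nat using (ℕ; zero; suc; _+_)
open import Data.Fin using (Fin; _≟_)
open import Data.Bool using (Bool; true; false; not; if_then_else_)
open import Data.Product using (Σ; ∃; ∃-syntax; _×_; _,_)
open import Data.List using (List; map; allFin)
open import Data.Nat.ListAction using (sum)
open import Relation.Nullary using (¬_)
open import Relation.Nullary.Decidable using (⌊_⌋)
open import Relation.Binary.PropositionalEquality using (_≡_; _≢_)

record Multigraph : Set where
  field
    n m      : ℕ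
    src tgt  : Fin m → Fin n
    loopless : ∀ e → src e ≢ tgt e

module _ (G : Multigraph) where
  open Multigraph G

  EdgeSet : Set
  EdgeSet = Fin m → Bool

  ind : Bool → ℕ
  ind true  = 1
  ind false = 0

  degIn : EdgeSet → Fin n → ℕ
  degIn S v = sum (map (λ e → if S e
                               then ind ⌊ src e ≟ v ⌋ + ind ⌊ tgt e ≟ v ⌋
                               else 0) (allFin m))

  allEdges : EdgeSet
  allEdges _ = true

  Cubic : Set
  Cubic = ∀ v → degIn allEdges v ≡ 3

  Bipartite : Set
  Bipartite = Σ (Fin n → Bool) λ c → ∀ (e : Fin m) → c (src e) ≢ c (tgt e)

  data ReachIn (S : EdgeSet) : Fin n → Fin n → Set where
    here  : ∀ {u} → ReachIn S u u
    fwd   : ∀ {u w} e → S e ≡ true → src e ≡ u → ReachIn S (tgt e) w → ReachIn S u w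
    bwd   : ∀ {u w} e → S e ≡ true → tgt e ≡ u → ReachIn S (src e) w → ReachIn S u w

  Connected : Set
  Connected = ∀ u v → ReachIn allEdges u v

  TwoFactor : EdgeSet → Set
  TwoFactor F = ∀ v → degIn F v ≡ 2

  -- e₁ and e₂ lie in the same cycle (connected component) of the 2-factor F
  SameCycle : EdgeSet → Fin m → Fin m → Set
  SameCycle F e₁ e₂ = F e₁ ≡ true × F e₂ ≡ true × ReachIn F (src e₁) (src e₂)

  -- Planarity via combinatorial embeddings (rotation systems).
  -- Darts: (e , true) is the end of e at src e, (e , false) the end at tgt e.
  Dart : Set
  Dart = Fin m × Bool

  head : Dart → Fin n
  head (e , true)  = src e
  head (e , false) = tgt e

  rev : Dart → Dart
  rev (e , b) = (e , not b)

  iter : {A : Set} → (A → A) → ℕ → A → A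
  iter f zero    x = x
  iter f (suc k) x = f (iter f k x)

  record RotationSystem : Set where
    field
      ρ ρ⁻¹     : Dart → Dart
      ρ⁻¹∘ρ     : ∀ d → ρ⁻¹ (ρ d) ≡ d
      ρ∘ρ⁻¹     : ∀ d → ρ (ρ⁻¹ d) ≡ d
      ρ-local   : ∀ d → head (ρ d) ≡ head d
      ρ-cyclic  : ∀ d d′ → head d ≡ head d′ → ∃[ k ] (iter ρ k d ≡ d′)

    φ : Dart → Dart
    φ d = ρ (rev d)

  -- the faces of a rotation system are the orbits of φ; 'f' is their number,
  -- witnessed by a surjective labelling whose fibres are exactly the orbits
  record Faces (R : RotationSystem) (f : ℕ) : Set where
    open RotationSystem R
    field
      face      : Dart → Fin f
      face-surj : ∀ i → ∃[ d ] (face d ≡ i)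
      face-orb  : ∀ d d′ → face d ≡ face d′ → ∃[ k ] (iter φ k d ≡ d′)
      orb-face  : ∀ d k → face (iter φ k d) ≡ face d

  -- Planar (for a connected graph): it has a rotation system of genus 0,
  -- i.e. satisfying Euler's formula V − E + F = 2.
  Planar : Set
  Planar = Σ RotationSystem λ R → ∃[ f ] (Faces R f × n + f ≡ m + 2)

{-# OPTIONS --safe #-}

-- A bipartite cubic map is a finite set of edges with two permutations β and ω all of whose
-- cycles have length three: the rotations at the black and at the white vertices.  The faces
-- are the orbits of β ∘ ω, a face of length 2k being an orbit of size k, and planarity enters
-- only as a lower bound on the number of labels of a labelling constant on faces; merging
-- labels makes this bound easy to maintain under deletion of edges.
--
-- The proof is by induction on the number of edges.  A digon is replaced by a single edge.
-- Without digons, Euler's formula gives at least six quadrangular faces, so some quadrangle has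
-- neither given edge on its boundary.  Delete it and reconnect its four outer edges in pairs;
-- a 2-factor of the smaller graph extends along the sides of the quadrangle, preserving cycles.
-- One of the two ways of pairing keeps the graph connected, since a bipartite cubic graph has
-- no bridge.
module Submission where

-- The constants fit as follows. Three edges at each vertex turn Euler's formula into |E| + 6 ≤ 3f.
-- Without digons every label is carried by at least two edges, so a surplus of six must come from
-- labels carried by exactly two, whereas two given edges border at most four faces. Removing a
-- digon costs three edges and one label, removing a quadrangle six edges and two labels: the
-- exchange rate of the inequality, which therefore survives both.
--
-- The given edges must stay off the quadrangle because its sides offer no freedom: if neither new
-- edge is used, the four sides form a cycle of their own. A digon does offer freedom, since a path
-- may take either parallel edge, so given edges are allowed there.
--
-- Connectedness has to be carried along, as the given edges could otherwise fall into different
-- components; this is why both pairings are considered. The second pairing is the first one after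
-- an exchange of the colours. A new edge reuses the name of one of the two outer edges it replaces,
-- so the edge type stays fixed while the list of live edges shrinks.

open import Defs
open import Data.Bool using (Bool; true; false; not; _∧_; if_then_else_)
import Data.Bool.Properties as Bool
open import Data.Empty using (⊥)
open import Data.Fin as Fin using (Fin)
open import Data.List using (List; []; _∷_; _++_; length; filter; map; concatMap; allFin)
open import Data.List.Properties using (length-++; length-tabulate; filter-notAll)
import Data.List.Membership.DecPropositional as DecMembership
open import Data.List.Membership.Propositional using (_∈_; _∉_; find; lose)
open import Data.List.Membership.Propositional.Properties using (∈-filter⁺; ∈-filter⁻; ∈-++⁺ˡ; ∈-++⁺ʳ; ∈-++⁻; ∈-∃++; ∈-map⁺; ∈-allFin)
open import Data.List.Relation.Unary.All as All using ([]; _∷_)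
open import Data.List.Relation.Unary.AllPairs using ([]; _∷_)
open import Data.List.Relation.Unary.Any as Any using (Any; here; there; any?)
open import Data.List.Relation.Unary.Unique.Propositional using (Unique)
import Data.List.Relation.Unary.Unique.Propositional.Properties as Unique
open import Data.Nat using (ℕ; zero; suc; _+_; _*_; _≤_; _<_; z≤n; s≤s; _≤?_)
open import Data.Nat.Divisibility using (_∣_; _∣0; ∣m∣n⇒∣m+n; ∣-refl; ∣m+n∣m⇒∣n; ∣1⇒≡1)
open import Data.Nat.ListAction using (sum)
import Data.Nat.Properties as ℕ
open import Data.Product using (Σ; ∃-syntax; _×_; _,_; proj₁; proj₂)
open import Data.Sum using (_⊎_; inj₁; inj₂; [_,_]′)
open import Function using (_∘_; id)
open import Relation.Binary.Construct.Closure.Equivalence as EqC using (EqClosure)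
open import Relation.Binary.Construct.Closure.ReflexiveTransitive using (Star; ε; _◅_; _◅◅_)
open import Relation.Binary.Construct.Closure.Symmetric using (SymClosure; fwd; bwd)
open import Relation.Binary.Definitions using (DecidableEquality)
open import Relation.Binary.PropositionalEquality using (_≡_; _≢_; refl; sym; trans; cong; cong₂; subst; subst₂; ≢-sym)
open import Relation.Nullary using (Dec; yes; no; contradiction; ¬?)
open import Relation.Nullary.Decidable using (⌊_⌋; does; dec-true; dec-false; _×-dec_; _⊎-dec_; map′)

-- Lists without repetition

private variable
  A B : Set

unique-⊆-length : {xs ys : List A} → Unique xs → (∀ {x} → x ∈ xs → x ∈ ys) → length xs ≤ length ys
unique-⊆-length {xs = []} _ _ = z≤n
unique-⊆-length {xs = x ∷ xs} (x≢ ∷ u) sub with ∈-∃++ (sub (here refl))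
... | as , bs , refl = ℕ.≤-trans (s≤s (unique-⊆-length u sub′)) (ℕ.≤-reflexive eq)
  where
  sub′ : ∀ {y} → y ∈ xs → y ∈ as ++ bs
  sub′ y∈ with ∈-++⁻ as (sub (there y∈))
  ... | inj₁ y∈as = ∈-++⁺ˡ y∈as
  ... | inj₂ (here refl) = contradiction refl (All.lookup x≢ y∈)
  ... | inj₂ (there y∈bs) = ∈-++⁺ʳ as y∈bs
  eq : suc (length (as ++ bs)) ≡ length (as ++ x ∷ bs)
  eq rewrite length-++ as {bs} | length-++ as {x ∷ bs} = sym (ℕ.+-suc (length as) (length bs))

unique-++⁻ : (xs : List A) {ys : List A} → Unique (xs ++ ys) → ∀ {y} → y ∈ ys → y ∉ xs
unique-++⁻ (x ∷ xs) (x≢ ∷ u) y∈ys (here refl) = All.lookup x≢ (∈-++⁺ʳ xs y∈ys) refl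
unique-++⁻ (x ∷ xs) (x≢ ∷ u) y∈ys (there y∈xs) = unique-++⁻ xs u y∈ys y∈xs

module _ (_≟_ : DecidableEquality A) where
  open DecMembership _≟_ using (_∈?_)

  infixl 6 _∖_
  _∖_ : List A → List A → List A
  xs ∖ ds = filter (λ x → ¬? (x ∈? ds)) xs

  ∈-∖⁺ : ∀ {x xs ds} → x ∈ xs → x ∉ ds → x ∈ xs ∖ ds
  ∈-∖⁺ {ds = ds} = ∈-filter⁺ (λ x → ¬? (x ∈? ds))

  ∈-∖⁻ : ∀ {x} xs ds → x ∈ xs ∖ ds → x ∈ xs × x ∉ ds
  ∈-∖⁻ xs ds = ∈-filter⁻ (λ x → ¬? (x ∈? ds))

  ∖-unique : ∀ {xs} ds → Unique xs → Unique (xs ∖ ds)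
  ∖-unique ds = Unique.filter⁺ (λ x → ¬? (x ∈? ds))

  length-∖-≥ : ∀ {xs} ds → Unique xs → length xs ≤ length ds + length (xs ∖ ds)
  length-∖-≥ {xs} ds u = subst (length xs ≤_) (length-++ ds) (unique-⊆-length u sub)
    where
    sub : ∀ {x} → x ∈ xs → x ∈ ds ++ xs ∖ ds
    sub {x} x∈ with x ∈? ds
    ... | yes x∈ds = ∈-++⁺ˡ x∈ds
    ... | no x∉ds = ∈-++⁺ʳ ds (∈-∖⁺ x∈ x∉ds)

  length-∖-≤ : ∀ {xs ds} → Unique xs → Unique ds → (∀ {x} → x ∈ ds → x ∈ xs) → length ds + length (xs ∖ ds) ≤ length xs
  length-∖-≤ {xs} {ds} u uds ds⊆ = subst (_≤ length xs) (length-++ ds) (unique-⊆-length uniq sub)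
    where
    uniq : Unique (ds ++ xs ∖ ds)
    uniq = Unique.++⁺ uds (∖-unique ds u) (λ (p , q) → proj₂ (∈-∖⁻ xs ds q) p)
    sub : ∀ {x} → x ∈ ds ++ xs ∖ ds → x ∈ xs
    sub x∈ with ∈-++⁻ ds x∈
    ... | inj₁ p = ds⊆ p
    ... | inj₂ q = proj₁ (∈-∖⁻ xs ds q)

  abstract
    -- The involutions and the extended 2-factors are finite tables over a default function. They
    -- are kept abstract, so that only the two lookup laws below are ever visible.
    assign : List (A × B) → (A → B) → A → B
    assign [] f x = f x
    assign ((a , b) ∷ t) f x with x ≟ a
    ... | yes _ = b
    ... | no _ = assign t f x

    assign-∈ : ∀ {a} {b : B} t {f} → Unique (map proj₁ t) → (a , b) ∈ t → assign t f a ≡ b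
    assign-∈ {a = a} ((a′ , _) ∷ t) (a′≢ ∷ u) p with a ≟ a′ | p
    ... | yes _ | here refl = refl
    ... | yes refl | there q = contradiction refl (All.lookup a′≢ (∈-map⁺ proj₁ q))
    ... | no a≢ | here refl = contradiction refl a≢
    ... | no _ | there q = assign-∈ t u q

    assign-∉ : ∀ {a} (t : List (A × B)) {f} → a ∉ map proj₁ t → assign t f a ≡ f a
    assign-∉ [] _ = refl
    assign-∉ {a = a} ((a′ , _) ∷ t) a∉ with a ≟ a′
    ... | yes a≡ = contradiction (here a≡) a∉
    ... | no _ = assign-∉ t (a∉ ∘ there)

  -- Saturation: while some unvisited element is one step away from `hs`, it is moved over. The fuel
  -- bounds the number of unvisited elements.
  reachable : {R : A → A → Set} (R? : ∀ x y → Dec (R x y)) (xs : List A) (r : A) →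
              Σ (List A) λ hs → r ∈ hs × (∀ {x} → x ∈ hs → Star R r x) × (∀ {x y} → x ∈ hs → y ∈ xs → R x y → y ∈ hs)
  reachable {R} R? xs r = grow (length xs) (r ∷ []) xs ℕ.≤-refl (λ { (here refl) → ε }) (here refl) inj₂
    where
    grow : ∀ n (hs us : List A) → length us ≤ n → (∀ {x} → x ∈ hs → Star R r x) → r ∈ hs → (∀ {x} → x ∈ xs → x ∈ hs ⊎ x ∈ us) →
           Σ (List A) λ hs → r ∈ hs × (∀ {x} → x ∈ hs → Star R r x) × (∀ {x y} → x ∈ hs → y ∈ xs → R x y → y ∈ hs)
    grow n hs us le star r∈ cover with any? (λ u → any? (λ h → R? h u) hs) us
    ... | no none = hs , r∈ , star , closed
      where
      closed : ∀ {x y} → x ∈ hs → y ∈ xs → R x y → y ∈ hs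
      closed x∈ y∈ xy with cover y∈
      ... | inj₁ p = p
      ... | inj₂ q = contradiction (lose q (lose x∈ xy)) none
    grow zero hs (_ ∷ _) () star r∈ cover | yes some
    grow (suc n) hs us le star r∈ cover | yes some with find some
    ... | u , u∈ , reach with find reach
    ...   | h , h∈ , hu = grow n (u ∷ hs) (filter (λ x → ¬? (x ≟ u)) us) (ℕ.≤-pred (ℕ.≤-trans (shorter us u∈) le)) star′ (there r∈) cover′
      where
      shorter : ∀ us → u ∈ us → length (filter (λ x → ¬? (x ≟ u)) us) < length us
      shorter us u∈ = filter-notAll (λ x → ¬? (x ≟ u)) us (Any.map (λ { refl ¬p → ¬p refl }) u∈)
      star′ : ∀ {x} → x ∈ u ∷ hs → Star R r x
      star′ (here refl) = star h∈ ◅◅ (hu ◅ ε)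
      star′ (there p) = star p
      cover′ : ∀ {x} → x ∈ xs → x ∈ u ∷ hs ⊎ x ∈ filter (λ x → ¬? (x ≟ u)) us
      cover′ {x} x∈ with cover x∈ | x ≟ u
      ... | inj₁ p | _ = inj₁ (there p)
      ... | inj₂ q | yes x≡u = inj₁ (here x≡u)
      ... | inj₂ q | no x≢u = inj₂ (∈-filter⁺ (λ x → ¬? (x ≟ u)) q x≢u)

-- Permutations with cycles of length three

-- In a cubic graph a 2-factor is the complement of a perfect matching: each vertex omits exactly
-- one of its three edges.
data OneFalse : Bool → Bool → Bool → Set where
  first  : OneFalse false true true
  second : OneFalse true false true
  third  : OneFalse true true false

rotate : ∀ {a b c} → OneFalse a b c → OneFalse b c a
rotate first = third
rotate second = first
rotate third = second

exchange : ∀ {a b c} → OneFalse a b c → OneFalse b a c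
exchange first = second
exchange second = first
exchange third = third

oneFalse-third : ∀ {a b c} → OneFalse a b c → c ≡ true → a ≡ true ⊎ b ≡ true
oneFalse-third first _ = inj₂ refl
oneFalse-third second _ = inj₁ refl

module _ {E : Set} where

  -- `L` lists the live edges of the current map; `τ` is unconstrained elsewhere, so deleting edges
  -- need not change the rotation.
  record Triad (L : List E) (τ : E → E) : Set where
    field
      closed : ∀ {x} → x ∈ L → τ x ∈ L
      cube   : ∀ {x} → x ∈ L → τ (τ (τ x)) ≡ x
      free   : ∀ {x} → x ∈ L → τ x ≢ x

    injective : ∀ {x y} → x ∈ L → y ∈ L → τ x ≡ τ y → x ≡ y
    injective x∈ y∈ eq = trans (sym (cube x∈)) (trans (cong (λ z → τ (τ z)) eq) (cube y∈))

    free² : ∀ {x} → x ∈ L → τ (τ x) ≢ x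
    free² x∈ eq = free x∈ (sym (trans (sym (cube x∈)) (cong τ eq)))

  triad-restrict : ∀ {L L′ τ} → Triad L τ → (∀ {x} → x ∈ L′ → x ∈ L) → (∀ {x} → x ∈ L′ → τ x ∈ L′) → Triad L′ τ
  triad-restrict T sub cl = record { closed = cl ; cube = cube ∘ sub ; free = free ∘ sub }
    where open Triad T

  triad-conjugate : ∀ {L τ} (σ : E → E) → (∀ x → σ (σ x) ≡ x) → (∀ {x} → x ∈ L → σ x ∈ L) →
                    Triad L τ → Triad L (λ x → σ (τ (σ x)))
  triad-conjugate {L} {τ} σ σσ σ∈ T = record { closed = σ∈ ∘ closed ∘ σ∈ ; cube = cube′ ; free = free′ }
    where
    open Triad T
    cube′ : ∀ {x} → x ∈ L → σ (τ (σ (σ (τ (σ (σ (τ (σ x)))))))) ≡ x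
    cube′ {x} x∈ rewrite σσ (τ (σ x)) | σσ (τ (τ (σ x))) | cube (σ∈ x∈) = σσ x
    free′ : ∀ {x} → x ∈ L → σ (τ (σ x)) ≢ x
    free′ {x} x∈ eq = free (σ∈ x∈) (trans (sym (σσ (τ (σ x)))) (cong σ eq))

  record Cycle₃ (τ : E → E) (a b c : E) : Set where
    constructor cycle₃
    field
      a→b : τ a ≡ b
      b→c : τ b ≡ c
      c→a : τ c ≡ a

  triad-cycle : ∀ {L τ} → Triad L τ → ∀ {x} → x ∈ L → Cycle₃ τ x (τ x) (τ (τ x))
  triad-cycle T x∈ = cycle₃ refl refl (Triad.cube T x∈)

  cycle₃-closed : ∀ {τ a b c x} → Cycle₃ τ a b c → x ∈ a ∷ b ∷ c ∷ [] → τ x ∈ a ∷ b ∷ c ∷ []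
  cycle₃-closed (cycle₃ refl refl _) (here refl) = there (here refl)
  cycle₃-closed (cycle₃ refl refl _) (there (here refl)) = there (there (here refl))
  cycle₃-closed (cycle₃ refl refl p) (there (there (here refl))) = here p

  OneFalseAt : (E → E) → (E → Bool) → E → Set
  OneFalseAt τ F x = OneFalse (F x) (F (τ x)) (F (τ (τ x)))

  cycle₃-oneFalse : ∀ {τ a b c} F → Cycle₃ τ a b c → OneFalse (F a) (F b) (F c) → ∀ {x} → x ∈ a ∷ b ∷ c ∷ [] → OneFalseAt τ F x
  cycle₃-oneFalse F (cycle₃ refl refl _) o (here refl) = o
  cycle₃-oneFalse {a = a} F (cycle₃ refl refl p) o (there (here refl)) rewrite p = rotate o
  cycle₃-oneFalse {a = a} F (cycle₃ refl refl p) o (there (there (here refl))) rewrite p = rotate (rotate o)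

  -- Connectivity relates edges rather than vertices. Two distinct edges at a cubic vertex are one
  -- rotation step apart in one of the two directions, so requiring both ends of a step in `P` loses
  -- no connection. With `P` a 2-factor the classes are its cycles.
  data Step (P : E → Set) (β ω : E → E) (x y : E) : Set where
    via-β : P x → P y → β x ≡ y → Step P β ω x y
    via-ω : P x → P y → ω x ≡ y → Step P β ω x y

  Conn : (E → Set) → (β ω : E → E) → E → E → Set
  Conn P β ω = EqClosure (Step P β ω)

  step-swap : ∀ {P β ω x y} → Step P β ω x y → Step P ω β x y
  step-swap (via-β p q e) = via-ω p q e
  step-swap (via-ω p q e) = via-β p q e

  β→ : ∀ {P : E → Set} {β ω x y} → P x → P y → β x ≡ y → Conn P β ω x y
  β→ p q e = EqC.return (via-β p q e)

  ω→ : ∀ {P : E → Set} {β ω x y} → P x → P y → ω x ≡ y → Conn P β ω x y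
  ω→ p q e = EqC.return (via-ω p q e)

  conn-sym : ∀ {P : E → Set} {β ω x y} → Conn P β ω x y → Conn P β ω y x
  conn-sym = EqC.symmetric _

  β← : ∀ {P : E → Set} {β ω x y} → P x → P y → β x ≡ y → Conn P β ω y x
  β← p q e = conn-sym (β→ p q e)

  ω← : ∀ {P : E → Set} {β ω x y} → P x → P y → ω x ≡ y → Conn P β ω y x
  ω← p q e = conn-sym (ω→ p q e)

  conn-reflexive : ∀ {P : E → Set} {β ω x y} → x ≡ y → Conn P β ω x y
  conn-reflexive refl = ε

  ConnectedMap : List E → (β ω : E → E) → Set
  ConnectedMap L β ω = ∀ {x y} → x ∈ L → y ∈ L → Conn (_∈ L) β ω x y

module _ {E : Set} (_≟_ : DecidableEquality E) where
  open DecMembership _≟_ using (_∈?_)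

  -- Orbits of three elements are peeled off one at a time; `n` bounds the length, as the remainder
  -- is not a structural part of the list.
  3∣length : ∀ {L τ} → Unique L → Triad {E} L τ → 3 ∣ length L
  3∣length {L} {τ} u T = go (length L) ℕ.≤-refl u T
    where
    go : ∀ n {L} → length L ≤ n → Unique L → Triad {E} L τ → 3 ∣ length L
    go n {[]} _ _ _ = 3 ∣0
    go (suc n) {L@(x ∷ xs)} le u T = subst (3 ∣_) (ℕ.≤-antisym lower upper)
        (∣m∣n⇒∣m+n ∣-refl (go n (ℕ.≤-trans shorter (ℕ.≤-pred le)) (∖-unique _≟_ ds u) T′))
      where
      open Triad T
      x∈ : x ∈ L
      x∈ = here refl
      ds = x ∷ τ x ∷ τ (τ x) ∷ []
      ds⊆ : ∀ {z} → z ∈ ds → z ∈ L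
      ds⊆ (here refl) = x∈
      ds⊆ (there (here refl)) = closed x∈
      ds⊆ (there (there (here refl))) = closed (closed x∈)
      dsu : Unique ds
      dsu = ((free x∈ ∘ sym) ∷ (free² x∈ ∘ sym) ∷ []) ∷ ((free (closed x∈) ∘ sym) ∷ []) ∷ [] ∷ []
      L′ = _∖_ _≟_ L ds
      lower : 3 + length L′ ≤ length L
      lower = length-∖-≤ _≟_ u dsu ds⊆
      upper : length L ≤ 3 + length L′
      upper = length-∖-≥ _≟_ ds u
      shorter : length L′ ≤ length xs
      shorter = ℕ.≤-trans (ℕ.m≤n+m (length L′) 2) (ℕ.≤-pred lower)
      T′ : Triad L′ τ
      T′ = triad-restrict T (proj₁ ∘ ∈-∖⁻ _≟_ L ds) λ z∈ → let z∈L , z∉ = ∈-∖⁻ _≟_ L ds z∈ in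
        ∈-∖⁺ _≟_ (closed z∈L) λ τz∈ → z∉ (subst (_∈ ds) (cube z∈L) (cycle₃-closed (triad-cycle T x∈) (cycle₃-closed (triad-cycle T x∈) τz∈)))

  step? : ∀ {P : E → Set} (P? : ∀ x → Dec (P x)) β ω x y → Dec (SymClosure (Step P β ω) x y)
  step? {P} P? β ω x y = map′ [ fwd , bwd ]′ (λ { (fwd s) → inj₁ s ; (bwd s) → inj₂ s }) (one x y ⊎-dec one y x)
    where
    one : ∀ x y → Dec (Step P β ω x y)
    one x y = map′ (λ { (p , q , inj₁ e) → via-β p q e ; (p , q , inj₂ e) → via-ω p q e })
                   (λ { (via-β p q e) → p , q , inj₁ e ; (via-ω p q e) → p , q , inj₂ e })
                   (P? x ×-dec P? y ×-dec ((β x ≟ y) ⊎-dec (ω x ≟ y)))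

  record Component (L : List E) (β ω : E → E) (r : E) : Set where
    field
      H     : List E
      uniq  : Unique H
      root  : r ∈ H
      sub   : ∀ {x} → x ∈ H → x ∈ L
      β∈    : ∀ {x} → x ∈ H → β x ∈ H
      ω∈    : ∀ {x} → x ∈ H → ω x ∈ H
      reach : ∀ {x} → x ∈ H → Conn (_∈ L) β ω r x

  component : ∀ {L β ω r} → Unique L → Triad L β → Triad L ω → r ∈ L → Component L β ω r
  component {L} {β} {ω} {r} u Tβ Tω r∈ with reachable _≟_ (step? (_∈? L) β ω) L r
  ... | hs , r∈hs , star , cl = record
    { H = filter (_∈? hs) L ; uniq = Unique.filter⁺ (_∈? hs) u ; root = ∈-filter⁺ (_∈? hs) r∈ r∈hs
    ; sub = proj₁ ∘ split ; reach = star ∘ proj₂ ∘ split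
    ; β∈ = λ x∈ → let x∈L , x∈hs = split x∈ ; y∈L = Triad.closed Tβ x∈L in
             ∈-filter⁺ (_∈? hs) y∈L (cl x∈hs y∈L (fwd (via-β x∈L y∈L refl)))
    ; ω∈ = λ x∈ → let x∈L , x∈hs = split x∈ ; y∈L = Triad.closed Tω x∈L in
             ∈-filter⁺ (_∈? hs) y∈L (cl x∈hs y∈L (fwd (via-ω x∈L y∈L refl))) }
    where
    split : ∀ {x} → x ∈ filter (_∈? hs) L → x ∈ L × x ∈ hs
    split = ∈-filter⁻ (_∈? hs)

  -- Counting modulo three: were p a bridge, the part X of the graph on the side of its
  -- white end would satisfy 3 ∣ |X| (black vertices) and 3 ∣ 1 + |X| (white vertices).
  bridgeless : ∀ {L β ω p} → Unique L → Triad L β → Triad L ω → p ∈ L → Conn (λ x → x ∈ L × x ≢ p) β ω (ω p) (β p)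
  bridgeless {L} {β} {ω} {p} u Tβ Tω p∈ with reachable _≟_ (step? (λ x → (x ∈? L) ×-dec ¬? (x ≟ p)) β ω) L (ω p)
  ... | hs , ωp∈ , star , cl with β p ∈? hs
  ...   | yes βp∈ = star βp∈
  ...   | no βp∉ = contradiction (∣1⇒≡1 (∣m+n∣m⇒∣n (subst (3 ∣_) (ℕ.+-comm 1 (length X)) (3∣length uX′ Tω′)) (3∣length uX Tβ′))) λ ()
    where
    module Β = Triad Tβ
    module Ω = Triad Tω
    Live : E → Set
    Live x = x ∈ hs × x ≢ p
    live? : ∀ x → Dec (Live x)
    live? x = (x ∈? hs) ×-dec ¬? (x ≟ p)
    X = filter live? L
    uX : Unique X
    uX = Unique.filter⁺ live? u
    split : ∀ {x} → x ∈ X → x ∈ L × Live x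
    split = ∈-filter⁻ live?
    join : ∀ {x} → x ∈ L → Live x → x ∈ X
    join = ∈-filter⁺ live?
    uX′ : Unique (p ∷ X)
    uX′ = All.tabulate (λ x∈ eq → proj₂ (proj₂ (split x∈)) (sym eq)) ∷ uX
    β∈ : ∀ {x} → x ∈ X → β x ∈ X
    β∈ {x} x∈ with split x∈
    ... | x∈L , x∈hs , x≢p with β x ≟ p
    ...   | no βx≢p = join (Β.closed x∈L) (cl x∈hs (Β.closed x∈L) (fwd (via-β (x∈L , x≢p) (Β.closed x∈L , βx≢p) refl)) , βx≢p)
    ...   | yes refl = contradiction (cl x∈hs (Β.closed p∈) (bwd (via-β (Β.closed p∈ , Β.free p∈) (x∈L , x≢p) (Β.cube x∈L)))) βp∉
    Tβ′ : Triad X β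
    Tβ′ = triad-restrict Tβ (proj₁ ∘ split) β∈
    ω∈ : ∀ {x} → x ∈ p ∷ X → ω x ∈ p ∷ X
    ω∈ (here refl) = there (join (Ω.closed p∈) (ωp∈ , Ω.free p∈))
    ω∈ {x} (there x∈) with split x∈
    ... | x∈L , x∈hs , x≢p with ω x ≟ p
    ...   | yes ωx≡p = here ωx≡p
    ...   | no ωx≢p = there (join (Ω.closed x∈L) (cl x∈hs (Ω.closed x∈L) (fwd (via-ω (x∈L , x≢p) (Ω.closed x∈L , ωx≢p) refl)) , ωx≢p))
    Tω′ : Triad (p ∷ X) ω
    Tω′ = triad-restrict Tω (λ { (here refl) → p∈ ; (there q) → proj₁ (split q) }) ω∈

-- Planar bipartite cubic maps and their reductions

module _ {E : Set} where

  -- For a connected planar cubic graph, V = 2E/3 and V - E + F = 2 give E + 6 = 3F. Distinct faces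
  -- may share a label, and labels outside `names` may occur, so `names` only bounds the number of
  -- faces from below.
  record FaceLabelling (K : Set) (L : List E) (β ω : E → E) : Set where
    field
      label     : E → K
      invariant : ∀ {x} → x ∈ L → label (β (ω x)) ≡ label x
      names     : List K
      unique    : Unique names
      hit       : ∀ {k} → k ∈ names → ∃[ x ] (x ∈ L × label x ≡ k)
      euler     : length L + 6 ≤ 3 * length names

  -- `β` conjugates `ω ∘ β` to `β ∘ ω`, hence carries the orbits of the former to those of the
  -- latter.
  faces-swap : ∀ {K L β ω} → Triad L β → FaceLabelling K L β ω → FaceLabelling K L ω β
  faces-swap {β = β} T Φ = record
    { label = label ∘ β ; invariant = invariant ∘ closed ; names = names ; unique = unique ; euler = euler
    ; hit = λ k∈ → let x , x∈ , eq = hit k∈ in β (β x) , closed (closed x∈) , trans (cong label (cube x∈)) eq }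
    where
    open Triad T
    open FaceLabelling Φ

  In : List E → (E → Bool) → E → Set
  In L F x = x ∈ L × F x ≡ true

  record Solution (L : List E) (β ω : E → E) (s t : E) : Set where
    field
      F    : E → Bool
      atβ  : ∀ {x} → x ∈ L → OneFalseAt β F x
      atω  : ∀ {x} → x ∈ L → OneFalseAt ω F x
      s∈F  : F s ≡ true
      t∈F  : F t ≡ true
      path : Conn (In L F) β ω s t

  solution-swap : ∀ {L β ω s t} → Solution L β ω s t → Solution L ω β s t
  solution-swap S = record { F = F ; atβ = atω ; atω = atβ ; s∈F = s∈F ; t∈F = t∈F ; path = EqC.map step-swap path }
    where open Solution S

-- Conjugating β by the involution σ detaches the closed set D of edges, which is then deleted.
module Reduction {E : Set} (_≟_ : DecidableEquality E) {L : List E} {β ω : E → E}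
  (uL : Unique L) (Tβ : Triad L β) (Tω : Triad L ω)
  (σ : E → E) (σσ : ∀ x → σ (σ x) ≡ x) (σ∈ : ∀ {x} → x ∈ L → σ x ∈ L)
  {D : List E} (uD : Unique D) (D⊆L : ∀ {x} → x ∈ D → x ∈ L)
  (Dβ : ∀ {x} → x ∈ D → σ (β (σ x)) ∈ D) (Dω : ∀ {x} → x ∈ D → ω x ∈ D) where

  open DecMembership _≟_ using (_∈?_)
  open Triad

  β′ : E → E
  β′ x = σ (β (σ x))

  L′ : List E
  L′ = _∖_ _≟_ L D

  split : ∀ {x} → x ∈ L′ → x ∈ L × x ∉ D
  split = ∈-∖⁻ _≟_ L D

  uL′ : Unique L′
  uL′ = ∖-unique _≟_ D uL

  shrink : length D + length L′ ≤ length L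
  shrink = length-∖-≤ _≟_ uL uD D⊆L

  Tσ : Triad L β′
  Tσ = triad-conjugate σ σσ σ∈ Tβ

  private
    restrict : ∀ {τ} → Triad L τ → (∀ {x} → x ∈ D → τ x ∈ D) → Triad L′ τ
    restrict {τ} T D∈ = triad-restrict T (proj₁ ∘ split) λ x∈ → let x∈L , x∉D = split x∈ in
      ∈-∖⁺ _≟_ (closed T x∈L) λ τx∈ → x∉D (subst (_∈ D) (cube T x∈L) (D∈ (D∈ τx∈)))

  Tβ′ : Triad L′ β′
  Tβ′ = restrict Tσ Dβ

  Tω′ : Triad L′ ω
  Tω′ = restrict Tω Dω

  -- Old connections are pushed forward along the retraction `r`, which sends every deleted edge to
  -- `t`. A β-step is a σ-step, a β′-step and a σ-step, so all that is left to require is that each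
  -- live edge moved by `σ` be connected to `t`.
  connected : ∀ {t} → t ∈ L′ → (∀ {x} → x ∈ L′ → σ x ≡ x ⊎ Conn (_∈ L′) β′ ω x t) →
              ConnectedMap L β ω → ConnectedMap L′ β′ ω
  connected {t} t∈ near conn {x} {y} x∈ y∈ =
    subst₂ (Conn (_∈ L′) β′ ω) (r-live x∈) (r-live y∈)
      (EqC.gfold (EqC.isEquivalence _) r step (conn (proj₁ (split x∈)) (proj₁ (split y∈))))
    where
    r : E → E
    r x with x ∈? D
    ... | yes _ = t
    ... | no _ = x
    r-live : ∀ {x} → x ∈ L′ → r x ≡ x
    r-live {x} x∈ with x ∈? D
    ... | yes x∈D = contradiction x∈D (proj₂ (split x∈))
    ... | no _ = refl
    r-dead : ∀ {x} → x ∈ D → r x ≡ t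
    r-dead {x} x∈ with x ∈? D
    ... | yes _ = refl
    ... | no x∉ = contradiction x∈ x∉
    _~_ : E → E → Set
    _~_ = Conn (_∈ L′) β′ ω
    r-σ : ∀ {x} → x ∈ L → r x ~ r (σ x)
    r-σ {x} x∈ with x ∈? D | σ x ∈? D
    ... | yes _ | yes _ = ε
    ... | no x∉ | yes σx∈ = [ (λ eq → contradiction (subst (_∈ D) eq σx∈) x∉) , id ]′ (near (∈-∖⁺ _≟_ x∈ x∉))
    ... | yes x∈D | no σx∉ with near (∈-∖⁺ _≟_ (σ∈ x∈) σx∉)
    ...   | inj₁ eq = contradiction (subst (_∈ D) (trans (sym (σσ x)) eq) x∈D) σx∉
    ...   | inj₂ c = conn-sym c
    r-σ {x} x∈ | no x∉ | no σx∉ with near (∈-∖⁺ _≟_ x∈ x∉) | near (∈-∖⁺ _≟_ (σ∈ x∈) σx∉)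
    ... | inj₁ eq | _ = conn-reflexive (sym eq)
    ... | inj₂ c | inj₁ eq = conn-reflexive (trans (sym (σσ x)) eq)
    ... | inj₂ c | inj₂ c′ = c ◅◅ conn-sym c′
    r-closed : (τ : E → E) → (∀ {x} → x ∈ D → τ x ∈ D) → (∀ {x} → x ∈ L′ → x ~ τ x) → (∀ {x} → x ∈ L′ → τ x ∈ L′) →
               ∀ {x} → x ∈ L → r x ~ r (τ x)
    r-closed τ D∈ link L′∈ {x} x∈ with x ∈? D
    ... | yes x∈D = conn-reflexive (sym (r-dead (D∈ x∈D)))
    ... | no x∉D = link live ◅◅ conn-reflexive (sym (r-live (L′∈ live)))
      where live = ∈-∖⁺ _≟_ x∈ x∉D
    step : ∀ {x y} → Step (_∈ L) β ω x y → r x ~ r y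
    step {x} (via-β x∈ _ refl) =
      r-σ x∈ ◅◅ r-closed β′ Dβ (λ z∈ → β→ z∈ (closed Tβ′ z∈) refl) (closed Tβ′) (σ∈ x∈)
             ◅◅ conn-reflexive (cong (λ z → r (σ (β z))) (σσ x)) ◅◅ conn-sym (r-σ (closed Tβ x∈))
    step (via-ω x∈ _ refl) = r-closed ω Dω (λ z∈ → ω→ z∈ (closed Tω′ z∈) refl) (closed Tω′) x∈

  module _ {K : Set} (_≟ᴷ_ : DecidableEquality K) (Φ : FaceLabelling K L β ω) where
    open FaceLabelling Φ

    -- Three deleted edges pay for one discarded name. Relabelling may affect only discarded names,
    -- and each surviving name needs a live bearer, which `rehit` supplies when the old one was
    -- deleted.
    faces : (lost : List K) → 3 * length lost ≤ length D → (label′ : E → K) →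
            (∀ {x} → label x ∉ lost → label′ x ≡ label x) →
            (∀ {x} → x ∈ L′ → label′ (β′ (ω x)) ≡ label′ x) →
            (∀ {x} → x ∈ D → label x ∈ lost ⊎ ∃[ y ] (y ∈ L′ × label y ≡ label x)) →
            FaceLabelling K L′ β′ ω
    faces lost cost label′ keep inv′ rehit = record
      { label = label′ ; invariant = inv′ ; names = names′ ; unique = ∖-unique _≟ᴷ_ lost unique
      ; hit = hit′ ; euler = ℕ.+-cancelˡ-≤ (length D) _ _ bound }
      where
      names′ : List K
      names′ = _∖_ _≟ᴷ_ names lost
      hit′ : ∀ {k} → k ∈ names′ → ∃[ x ] (x ∈ L′ × label′ x ≡ k)
      hit′ k∈ with ∈-∖⁻ _≟ᴷ_ names lost k∈
      ... | k∈names , k∉lost with hit k∈names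
      ...   | x , x∈ , refl with x ∈? D
      ...     | no x∉ = x , ∈-∖⁺ _≟_ x∈ x∉ , keep k∉lost
      ...     | yes x∈D with rehit x∈D
      ...       | inj₁ l = contradiction l k∉lost
      ...       | inj₂ (y , y∈ , eq) = y , y∈ , trans (keep (k∉lost ∘ subst (_∈ lost) eq)) eq
      open ℕ.≤-Reasoning
      bound : length D + (length L′ + 6) ≤ length D + 3 * length names′
      bound = begin
        length D + (length L′ + 6)                ≡⟨ ℕ.+-assoc (length D) _ 6 ⟨
        length D + length L′ + 6                  ≤⟨ ℕ.+-monoˡ-≤ 6 shrink ⟩
        length L + 6                              ≤⟨ euler ⟩
        3 * length names                          ≤⟨ ℕ.*-monoʳ-≤ 3 (length-∖-≥ _≟ᴷ_ lost unique) ⟩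
        3 * (length lost + length names′)         ≡⟨ ℕ.*-distribˡ-+ 3 (length lost) _ ⟩
        3 * length lost + 3 * length names′       ≤⟨ ℕ.+-monoˡ-≤ _ cost ⟩
        length D + 3 * length names′              ∎

  -- Invariance of `F` under `σ` carries the condition at black vertices from `β′` back to `β`. A
  -- β′-step from `x` factors through `σ x`, so `link`, a detour inside the 2-factor from `x` to
  -- `σ x`, lifts the paths of the reduced 2-factor.
  module Lift {s′ t′ : E} (S′ : Solution L′ β′ ω s′ t′) (F : E → Bool)
    (F≗F′ : ∀ {x} → x ∈ L′ → F x ≡ Solution.F S′ x) (F∘σ : ∀ x → F (σ x) ≡ F x)
    (deadβ : ∀ {x} → x ∈ D → OneFalseAt β′ F x) (deadω : ∀ {x} → x ∈ D → OneFalseAt ω F x)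
    (link : ∀ {x} → x ∈ L′ → F x ≡ true → Conn (In L F) β ω x (σ x)) where

    private
      module S′ = Solution S′

      extend : ∀ {τ} → Triad L′ τ → (∀ {x} → x ∈ L′ → OneFalseAt τ S′.F x) → (∀ {x} → x ∈ D → OneFalseAt τ F x) →
               ∀ {x} → x ∈ L → OneFalseAt τ F x
      extend T live dead {x} x∈ with x ∈? D
      ... | yes x∈D = dead x∈D
      ... | no x∉D with ∈-∖⁺ _≟_ x∈ x∉D
      ...   | x∈L′ rewrite F≗F′ x∈L′ | F≗F′ (closed T x∈L′) | F≗F′ (closed T (closed T x∈L′)) = live x∈L′

      atβ : ∀ {x} → x ∈ L → OneFalseAt β F x
      atβ {x} x∈ with extend Tβ′ S′.atβ deadβ (σ∈ x∈)
      ... | o rewrite σσ x | σσ (β x) | F∘σ x | F∘σ (β x) | F∘σ (β (β x)) = o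

      _~_ : E → E → Set
      _~_ = Conn (In L F) β ω

      lift-in : ∀ {x} → In L′ S′.F x → In L F x
      lift-in (x∈ , eq) = proj₁ (split x∈) , trans (F≗F′ x∈) eq

      σ-in : ∀ {x} → In L F x → In L F (σ x)
      σ-in {x} (x∈ , eq) = σ∈ x∈ , trans (F∘σ x) eq

      step : ∀ {x y} → Step (In L′ S′.F) β′ ω x y → x ~ y
      step {x} (via-β p q refl) =
        link (proj₁ p) (proj₂ (lift-in p)) ◅◅ β→ (σ-in (lift-in p)) (subst (In L F) (σσ (β (σ x))) (σ-in (lift-in q))) refl
          ◅◅ conn-sym (subst (β′ x ~_) (σσ (β (σ x))) (link (proj₁ q) (proj₂ (lift-in q))))
      step (via-ω p q eq) = ω→ (lift-in p) (lift-in q) eq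

    -- A live edge `z` moved by `σ` stands for two old edges, `z` and `σ z`, each contributing one
    -- end; either may be a prescribed edge.
    attach : ∀ {x z} → z ∈ L′ → S′.F z ≡ true → x ≡ z ⊎ x ≡ σ z → F x ≡ true × Conn (In L F) β ω x z
    attach z∈ eq (inj₁ refl) = trans (F≗F′ z∈) eq , ε
    attach {z = z} z∈ eq (inj₂ refl) = trans (F∘σ z) Fz , conn-sym (link z∈ Fz)
      where Fz = trans (F≗F′ z∈) eq

    solution : ∀ {s t} → F s ≡ true → F t ≡ true → Conn (In L F) β ω s t → Solution L β ω s t
    solution Fs Ft c = record { F = F ; atβ = atβ ; atω = extend Tω′ S′.atω deadω ; s∈F = Fs ; t∈F = Ft ; path = c }

    solution-attached : ∀ {s t} → F s ≡ true × Conn (In L F) β ω s s′ → F t ≡ true × Conn (In L F) β ω t t′ → Solution L β ω s t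
    solution-attached (Fs , s~) (Ft , t~) = solution Fs Ft (s~ ◅◅ EqC.gfold (EqC.isEquivalence _) id step S′.path ◅◅ conn-sym t~)

record PlanarMap {E : Set} (K : Set) (L : List E) (β ω : E → E) : Set where
  field
    uL       : Unique L
    Tβ       : Triad L β
    Tω       : Triad L ω
    conn     : ConnectedMap L β ω
    faces    : FaceLabelling K L β ω

planarMap-swap : ∀ {E K : Set} {L : List E} {β ω} → PlanarMap K L β ω → PlanarMap K L ω β
planarMap-swap M = record { uL = uL ; Tβ = Tω ; Tω = Tβ ; conn = λ x∈ y∈ → EqC.map step-swap (conn x∈ y∈) ; faces = faces-swap Tβ faces }
  where open PlanarMap M

-- Digons

module Theta {E : Set} (_≟_ : DecidableEquality E) {L : List E} {β ω : E → E} (Tβ : Triad L β) (Tω : Triad L ω) where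

  reorder : ∀ {a b c x : E} → x ∈ a ∷ b ∷ c ∷ [] → x ∈ b ∷ a ∷ c ∷ []
  reorder (here e) = there (here e)
  reorder (there (here e)) = here e
  reorder (there (there p)) = there (there p)

  omit-third : ∀ {a b c s t} → Cycle₃ β a b c → Cycle₃ ω b a c → Unique (c ∷ a ∷ b ∷ []) →
               (∀ {x} → x ∈ a ∷ b ∷ c ∷ [] → x ∈ L) → (∀ {x} → x ∈ L → x ∈ a ∷ b ∷ c ∷ []) →
               s ∈ a ∷ b ∷ [] → t ∈ a ∷ b ∷ [] → Solution L β ω s t
  omit-third {a} {b} {c} cβ cω u into from s∈ t∈ = record
    { F = F ; atβ = λ x∈ → cycle₃-oneFalse F cβ third′ (from x∈)
    ; atω = λ x∈ → cycle₃-oneFalse F cω third″ (reorder (from x∈))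
    ; s∈F = kept s∈ ; t∈F = kept t∈ ; path = to-a s∈ ◅◅ conn-sym (to-a t∈) }
    where
    F : E → Bool
    F = assign _≟_ ((c , false) ∷ []) (λ _ → true)
    Fc : F c ≡ false
    Fc = assign-∈ _≟_ ((c , false) ∷ []) ([] ∷ []) (here refl)
    kept : ∀ {x} → x ∈ a ∷ b ∷ [] → F x ≡ true
    kept x∈ = assign-∉ _≟_ ((c , false) ∷ []) (unique-++⁻ (c ∷ []) u x∈)
    third′ : OneFalse (F a) (F b) (F c)
    third′ rewrite Fc | kept (here refl) | kept (there (here refl)) = third
    third″ : OneFalse (F b) (F a) (F c)
    third″ rewrite Fc | kept (here refl) | kept (there (here refl)) = third
    to-a : ∀ {x} → x ∈ a ∷ b ∷ [] → Conn (In L F) β ω x a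
    to-a (here refl) = ε
    to-a (there (here refl)) = ω→ (into (there (here refl)) , kept (there (here refl))) (into (here refl) , kept (here refl)) (Cycle₃.a→b cω)

  -- The three edges are closed under both rotations, so by connectedness they are all of `L`.
  -- Omitting one that is neither `s` nor `t` leaves a single cycle.
  theta : ∀ {a b c s t} → Cycle₃ β a b c → Cycle₃ ω b a c → Unique (a ∷ b ∷ c ∷ []) →
          (∀ {x} → x ∈ a ∷ b ∷ c ∷ [] → x ∈ L) → ConnectedMap L β ω → s ∈ L → t ∈ L → Solution L β ω s t
  theta {a} {b} {c} {s} {t} cβ@(cycle₃ ab bc ca) cω@(cycle₃ ba ac cb) ((a≢b ∷ a≢c ∷ []) ∷ (b≢c ∷ []) ∷ _) into conn s∈ t∈ =
    choose (from s∈) (from t∈)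
    where
    D = a ∷ b ∷ c ∷ []
    Same : E → E → Set
    Same x y = (x ∈ D → y ∈ D) × (y ∈ D → x ∈ D)
    same : ∀ {x y} → Step (_∈ L) β ω x y → Same x y
    same (via-β x∈ _ refl) = cycle₃-closed cβ , λ y∈ → subst (_∈ D) (Triad.cube Tβ x∈) (cycle₃-closed cβ (cycle₃-closed cβ y∈))
    same (via-ω x∈ _ refl) = reorder ∘ cycle₃-closed cω ∘ reorder ,
      λ y∈ → subst (_∈ D) (Triad.cube Tω x∈) (reorder (cycle₃-closed cω (cycle₃-closed cω (reorder y∈))))
    from : ∀ {x} → x ∈ L → x ∈ D
    from x∈ = proj₁ (EqC.fold {S = Same}
      (record { refl = id , id ; sym = λ (f , g) → g , f ; trans = λ (f , g) (h , k) → h ∘ f , g ∘ k })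
      same (conn (into (here refl)) x∈)) (here refl)
    turn : ∀ {a b c x : E} → x ∈ b ∷ c ∷ a ∷ [] → x ∈ a ∷ b ∷ c ∷ []
    turn (here e) = there (here e)
    turn (there (here e)) = there (there (here e))
    turn (there (there (here e))) = here e
    turn⁻ : ∀ {a b c x : E} → x ∈ a ∷ b ∷ c ∷ [] → x ∈ b ∷ c ∷ a ∷ []
    turn⁻ (here e) = there (there (here e))
    turn⁻ (there (here e)) = here e
    turn⁻ (there (there (here e))) = there (here e)
    omit-c : ∀ {s t} → s ∈ a ∷ b ∷ [] → t ∈ a ∷ b ∷ [] → Solution L β ω s t
    omit-c = omit-third cβ cω ((≢-sym a≢c ∷ ≢-sym b≢c ∷ []) ∷ (a≢b ∷ []) ∷ [] ∷ []) into from
    omit-a : ∀ {s t} → s ∈ b ∷ c ∷ [] → t ∈ b ∷ c ∷ [] → Solution L β ω s t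
    omit-a = omit-third (cycle₃ bc ca ab) (cycle₃ cb ba ac) ((a≢b ∷ a≢c ∷ []) ∷ (b≢c ∷ []) ∷ [] ∷ []) (into ∘ turn) (turn⁻ ∘ from)
    omit-b : ∀ {s t} → s ∈ c ∷ a ∷ [] → t ∈ c ∷ a ∷ [] → Solution L β ω s t
    omit-b = omit-third (cycle₃ ca ab bc) (cycle₃ ac cb ba) ((b≢c ∷ ≢-sym a≢b ∷ []) ∷ (≢-sym a≢c ∷ []) ∷ [] ∷ [])
      (into ∘ turn ∘ turn) (turn⁻ ∘ turn⁻ ∘ from)
    choose : ∀ {s t} → s ∈ D → t ∈ D → Solution L β ω s t
    choose (here s) (here t) = omit-c (here s) (here t)
    choose (here s) (there (here t)) = omit-c (here s) (there (here t))
    choose (here s) (there (there (here t))) = omit-b (there (here s)) (here t)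
    choose (there (here s)) (here t) = omit-c (there (here s)) (here t)
    choose (there (here s)) (there (here t)) = omit-c (there (here s)) (there (here t))
    choose (there (here s)) (there (there (here t))) = omit-a (here s) (there (here t))
    choose (there (there (here s))) (here t) = omit-b (here s) (there (here t))
    choose (there (there (here s))) (there (here t)) = omit-a (there (here s)) (here t)
    choose (there (there (here s))) (there (there (here t))) = omit-a (there (here s)) (there (here t))

-- `x` and `y` are the parallel edges, `p` is the third edge at their black end and `q` the third at
-- their white end. If `p` and `q` differ, exchanging their black ends closes `q`, `x`, `y` up to a
-- separate theta and leaves `p` as the edge replacing the digon.
module Digon {E K : Set} (_≟_ : DecidableEquality E) (_≟ᴷ_ : DecidableEquality K)
  {L : List E} {β ω : E → E} (M : PlanarMap K L β ω) {y : E} (y∈ : y ∈ L) (digon : β (ω y) ≡ y) where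

  open DecMembership _≟_ using (_∈?_)
  open PlanarMap M
  private
    module Β = Triad Tβ
    module Ω = Triad Tω
    module Φ = FaceLabelling faces

  x q p : E
  x = ω y
  q = ω x
  p = β y

  x∈ : x ∈ L
  x∈ = Ω.closed y∈

  q∈ : q ∈ L
  q∈ = Ω.closed x∈

  p∈ : p ∈ L
  p∈ = Β.closed y∈

  cycleω : Cycle₃ ω y x q
  cycleω = triad-cycle Tω y∈

  βp≡x : β p ≡ x
  βp≡x = trans (cong (λ z → β (β z)) (sym digon)) (Β.cube x∈)

  p≢x : p ≢ x
  p≢x eq = Β.free p∈ (trans βp≡x (sym eq))

  p≢y : p ≢ y
  p≢y = Β.free y∈

  x≢y : x ≢ y
  x≢y = Ω.free y∈

  solve-theta : ∀ {s t} → p ≡ q → s ∈ L → t ∈ L → Solution L β ω s t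
  solve-theta p≡q = Theta.theta _≟_ Tβ Tω
    (cycle₃ digon refl βp≡x) (cycle₃ refl (sym p≡q) (trans (cong ω p≡q) (Ω.cube y∈)))
    ((x≢y ∷ ≢-sym p≢x ∷ []) ∷ (≢-sym p≢y ∷ []) ∷ [] ∷ [])
    (λ { (here refl) → x∈ ; (there (here refl)) → y∈ ; (there (there (here refl))) → p∈ }) conn

  module _ (p≢q : p ≢ q) where

    D : List E
    D = q ∷ x ∷ y ∷ []

    uD : Unique D
    uD = (Ω.free x∈ ∷ Ω.free² y∈ ∷ []) ∷ (x≢y ∷ []) ∷ [] ∷ []

    uniq : Unique (p ∷ D)
    uniq = (p≢q ∷ p≢x ∷ p≢y ∷ []) ∷ uD

    pairs : List (E × E)
    pairs = (p , q) ∷ (q , p) ∷ []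

    σ : E → E
    σ = assign _≟_ pairs id

    σp : σ p ≡ q
    σp = assign-∈ _≟_ pairs (Unique.take⁺ 2 uniq) (here refl)

    σq : σ q ≡ p
    σq = assign-∈ _≟_ pairs (Unique.take⁺ 2 uniq) (there (here refl))

    σ-fix : ∀ {z} → z ∉ p ∷ q ∷ [] → σ z ≡ z
    σ-fix = assign-∉ _≟_ pairs

    σx : σ x ≡ x
    σx = σ-fix (unique-++⁻ (p ∷ q ∷ []) uniq (here refl))

    σy : σ y ≡ y
    σy = σ-fix (unique-++⁻ (p ∷ q ∷ []) uniq (there (here refl)))

    σ-elim : (P : E → E → Set) → P p q → P q p → (∀ z → P z z) → ∀ z → P z (σ z)
    σ-elim P pq qp same z with z ∈? (p ∷ q ∷ [])
    ... | yes (here refl) = subst (P z) (sym σp) pq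
    ... | yes (there (here refl)) = subst (P z) (sym σq) qp
    ... | no z∉ = subst (P z) (sym (σ-fix z∉)) (same z)

    σσ : ∀ z → σ (σ z) ≡ z
    σσ z = σ-elim (λ z w → σ z ≡ w → σ w ≡ z) (λ _ → σq) (λ _ → σp) (λ _ → id) z refl

    σ∈ : ∀ {z} → z ∈ L → σ z ∈ L
    σ∈ {z} = σ-elim (λ z w → z ∈ L → w ∈ L) (λ _ → q∈) (λ _ → p∈) (λ _ → id) z

    cycleβ′ : Cycle₃ (λ z → σ (β (σ z))) x y q
    cycleβ′ = cycle₃ (trans (cong (σ ∘ β) σx) (trans (cong σ digon) σy)) (trans (cong (σ ∘ β) σy) σp)
                     (trans (cong (σ ∘ β) σq) (trans (cong σ βp≡x) σx))

    D⇒β : ∀ {z} → z ∈ D → z ∈ x ∷ y ∷ q ∷ []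
    D⇒β (here e) = there (there (here e))
    D⇒β (there (here e)) = here e
    D⇒β (there (there (here e))) = there (here e)

    β⇒D : ∀ {z} → z ∈ x ∷ y ∷ q ∷ [] → z ∈ D
    β⇒D (here e) = there (here e)
    β⇒D (there (here e)) = there (there (here e))
    β⇒D (there (there (here e))) = here e

    D⇒ω : ∀ {z} → z ∈ D → z ∈ y ∷ x ∷ q ∷ []
    D⇒ω (here e) = there (there (here e))
    D⇒ω (there (here e)) = there (here e)
    D⇒ω (there (there (here e))) = here e

    ω⇒D : ∀ {z} → z ∈ y ∷ x ∷ q ∷ [] → z ∈ D
    ω⇒D (here e) = there (there (here e))
    ω⇒D (there (here e)) = there (here e)
    ω⇒D (there (there (here e))) = here e

    D⊆L : ∀ {z} → z ∈ D → z ∈ L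
    D⊆L (here refl) = q∈
    D⊆L (there (here refl)) = x∈
    D⊆L (there (there (here refl))) = y∈

    open Reduction _≟_ uL Tβ Tω σ σσ σ∈ uD D⊆L (β⇒D ∘ cycle₃-closed cycleβ′ ∘ D⇒β) (ω⇒D ∘ cycle₃-closed cycleω ∘ D⇒ω)
      public renaming (connected to reduce-connected; faces to reduce-faces)

    p∈′ : p ∈ L′
    p∈′ = ∈-∖⁺ _≟_ p∈ (Unique.Unique[x∷xs]⇒x∉xs uniq)

    σ-fix′ : ∀ {z} → z ∈ L′ → z ≢ p → σ z ≡ z
    σ-fix′ z∈ z≢p = σ-fix λ { (here e) → z≢p e ; (there (here refl)) → proj₂ (split z∈) (here refl) }

    label-σ : ∀ z → Φ.label (σ z) ≡ Φ.label z
    label-σ = σ-elim (λ z w → Φ.label w ≡ Φ.label z) (sym pq) pq (λ _ → refl)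
      where
      pq : Φ.label p ≡ Φ.label q
      pq = trans (cong (Φ.label ∘ β) (sym (Ω.cube y∈))) (Φ.invariant q∈)

    label-βq : Φ.label (β′ p) ≡ Φ.label x
    label-βq = trans (label-σ _) (trans (cong (Φ.label ∘ β) σp) (Φ.invariant x∈))

    reduced : PlanarMap K L′ β′ ω
    reduced = record
      { uL = uL′ ; Tβ = Tβ′ ; Tω = Tω′
      ; conn = reduce-connected p∈′ near conn
      -- `Φ.label y` is the label of the digon face, an orbit of size one; the three deleted edges
      -- pay for it exactly.
      ; faces = reduce-faces _≟ᴷ_ faces (Φ.label y ∷ []) ℕ.≤-refl Φ.label (λ _ → refl) inv rehit }
      where
      near : ∀ {z} → z ∈ L′ → σ z ≡ z ⊎ Conn (_∈ L′) β′ ω z p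
      near {z} z∈ with z ≟ p
      ... | yes refl = inj₂ ε
      ... | no z≢p = inj₁ (σ-fix′ z∈ z≢p)
      inv : ∀ {z} → z ∈ L′ → Φ.label (β′ (ω z)) ≡ Φ.label z
      inv {z} z∈ with ω z ≟ p
      -- The old face went from `z` through `x` to `β q`; the new one skips `x` and keeps the label.
      ... | yes ωz≡p = trans (cong (Φ.label ∘ β′) ωz≡p) (trans label-βq
            (trans (cong Φ.label (sym (trans (cong β ωz≡p) βp≡x))) (Φ.invariant (proj₁ (split z∈)))))
      ... | no ωz≢p = trans (label-σ _) (trans (cong (Φ.label ∘ β) (σ-fix′ (Triad.closed Tω′ z∈) ωz≢p)) (Φ.invariant (proj₁ (split z∈))))
      rehit : ∀ {z} → z ∈ D → Φ.label z ∈ Φ.label y ∷ [] ⊎ ∃[ w ] (w ∈ L′ × Φ.label w ≡ Φ.label z)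
      rehit (here refl) = inj₂ (p , p∈′ , trans (cong Φ.label (sym σq)) (label-σ q))
      rehit (there (here refl)) = inj₂ (β′ p , Triad.closed Tβ′ p∈′ , label-βq)
      rehit (there (there (here refl))) = inj₁ (here refl)

    Home : E → Set
    Home s = ∃[ z ] (z ∈ L′ × ((s ≡ z ⊎ s ≡ σ z) ⊎ (z ≡ p × (s ≡ x ⊎ s ≡ y))))

    home : ∀ {s} → s ∈ L → Home s
    home {s} s∈ with s ∈? D
    ... | no s∉ = s , ∈-∖⁺ _≟_ s∈ s∉ , inj₁ (inj₁ refl)
    ... | yes (here refl) = p , p∈′ , inj₁ (inj₂ (sym σp))
    ... | yes (there (here refl)) = p , p∈′ , inj₂ (refl , inj₁ refl)
    ... | yes (there (there (here refl))) = p , p∈′ , inj₂ (refl , inj₂ refl)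

    -- If `p` is used, exactly one of `x`, `y` is, and either will do; if not, both are, and the
    -- digon is a cycle. Leaving the choice open allows `s` or `t` to lie on the digon.
    module _ {s′ t′ : E} (S′ : Solution L′ β′ ω s′ t′) (fx fy : Bool) (o : OneFalse fx fy (Solution.F S′ p)) where

      private module S′ = Solution S′

      values : List (E × Bool)
      values = (q , S′.F p) ∷ (x , fx) ∷ (y , fy) ∷ []

      F : E → Bool
      F = assign _≟_ values S′.F

      F-live : ∀ {z} → z ∈ L′ → F z ≡ S′.F z
      F-live z∈ = assign-∉ _≟_ values (proj₂ (split z∈))

      Fq : F q ≡ S′.F p
      Fq = assign-∈ _≟_ values uD (here refl)

      Fx : F x ≡ fx
      Fx = assign-∈ _≟_ values uD (there (here refl))

      Fy : F y ≡ fy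
      Fy = assign-∈ _≟_ values uD (there (there (here refl)))

      link-pq : F p ≡ true → Conn (In L F) β ω p q
      link-pq Fp with oneFalse-third o (trans (sym (F-live p∈′)) Fp)
      ... | inj₁ eq = β→ (p∈ , Fp) (x∈ , trans Fx eq) βp≡x ◅◅ ω→ (x∈ , trans Fx eq) q-in refl
        where q-in = q∈ , trans Fq (trans (sym (F-live p∈′)) Fp)
      ... | inj₂ eq = β← (y∈ , trans Fy eq) (p∈ , Fp) refl ◅◅ ω← q-in (y∈ , trans Fy eq) (Ω.cube y∈)
        where q-in = q∈ , trans Fq (trans (sym (F-live p∈′)) Fp)

      oβ : OneFalse (F x) (F y) (F q)
      oβ rewrite Fx | Fy | Fq = o

      oω : OneFalse (F y) (F x) (F q)
      oω rewrite Fx | Fy | Fq = exchange o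

      F-σ : ∀ z → F (σ z) ≡ F z
      F-σ = σ-elim (λ z w → F w ≡ F z) (trans Fq (sym (F-live p∈′))) (trans (F-live p∈′) (sym Fq)) (λ _ → refl)

      link : ∀ {z} → z ∈ L′ → F z ≡ true → Conn (In L F) β ω z (σ z)
      link {z} z∈ Fz with z ≟ p
      ... | yes refl = subst (Conn (In L F) β ω p) (sym σp) (link-pq Fz)
      ... | no z≢p = conn-reflexive (sym (σ-fix′ z∈ z≢p))

      open Lift S′ F F-live F-σ (cycle₃-oneFalse F cycleβ′ oβ ∘ D⇒β) (cycle₃-oneFalse F cycleω oω ∘ D⇒ω) link public

      attach-home : ∀ {s} (h : Home s) → S′.F (proj₁ h) ≡ true → (s ≡ x → fx ≡ true) → (s ≡ y → fy ≡ true) →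
                    F s ≡ true × Conn (In L F) β ω s (proj₁ h)
      attach-home (z , z∈ , inj₁ near) Fz _ _ = attach z∈ Fz near
      attach-home (_ , _ , inj₂ (refl , inj₁ refl)) Fz ok _ =
        trans Fx (ok refl) , β← (p∈ , trans (F-live p∈′) Fz) (x∈ , trans Fx (ok refl)) βp≡x
      attach-home (_ , _ , inj₂ (refl , inj₂ refl)) Fz _ ok =
        trans Fy (ok refl) , β→ (y∈ , trans Fy (ok refl)) (p∈ , trans (F-live p∈′) Fz) refl

    solve-digon : (∀ {s′ t′} → s′ ∈ L′ → t′ ∈ L′ → Solution L′ β′ ω s′ t′) → ∀ {s t} → s ∈ L → t ∈ L → Solution L β ω s t
    solve-digon ih {s} {t} s∈ t∈ with x ∈? (s ∷ t ∷ []) | y ∈? (s ∷ t ∷ [])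
    -- `y` is put into the 2-factor in any case, as it may be `s` or `t`; `x` absorbs the condition
    -- at the two vertices.
    ... | no x∉ | _ = solution-attached S′ fx true o
          (attach-home S′ fx true o hs (Solution.s∈F S′) (λ e → contradiction (here (sym e)) x∉) (λ _ → refl))
          (attach-home S′ fx true o ht (Solution.t∈F S′) (λ e → contradiction (there (here (sym e))) x∉) (λ _ → refl))
      where
      hs = home s∈
      ht = home t∈
      S′ = ih (proj₁ (proj₂ hs)) (proj₁ (proj₂ ht))
      fx = not (Solution.F S′ p)
      o : OneFalse fx true (Solution.F S′ p)
      o with Solution.F S′ p
      ... | true = first
      ... | false = third
    ... | yes _ | no y∉ = solution-attached S′ true fy o
          (attach-home S′ true fy o hs (Solution.s∈F S′) (λ _ → refl) (λ e → contradiction (here (sym e)) y∉))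
          (attach-home S′ true fy o ht (Solution.t∈F S′) (λ _ → refl) (λ e → contradiction (there (here (sym e))) y∉))
      where
      hs = home s∈
      ht = home t∈
      S′ = ih (proj₁ (proj₂ hs)) (proj₁ (proj₂ ht))
      fy = not (Solution.F S′ p)
      o : OneFalse true fy (Solution.F S′ p)
      o with Solution.F S′ p
      ... | true = second
      ... | false = third
    -- If s and t are the two parallel edges, the digon itself must be a cycle of the 2-factor.
    ... | yes x∈st | yes y∈st = both x∈st y∈st
      where
      βp∈ = Triad.closed Tβ′ p∈′
      -- Prescribing the two other edges at the black end of `p` forces `p` out of the 2-factor, so
      -- that `x` and `y` can both be used.
      S′ = ih βp∈ (Triad.closed Tβ′ βp∈)
      o : OneFalse true true (Solution.F S′ p)
      o with Solution.F S′ p | Solution.F S′ (β′ p) | Solution.F S′ (β′ (β′ p)) | Solution.atβ S′ p∈′ | Solution.s∈F S′ | Solution.t∈F S′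
      ... | _ | _ | _ | first | _ | _ = third
      F⁺ = F S′ true true o
      xy : Conn (In L F⁺) β ω x y
      xy = ω← (y∈ , Fy S′ true true o) (x∈ , Fx S′ true true o) refl
      both : x ∈ s ∷ t ∷ [] → y ∈ s ∷ t ∷ [] → Solution L β ω s t
      both (here refl) (here e) = contradiction (sym e) x≢y
      both (here refl) (there (here refl)) = solution S′ true true o (Fx S′ true true o) (Fy S′ true true o) xy
      both (there (here refl)) (here refl) = solution S′ true true o (Fy S′ true true o) (Fx S′ true true o) (conn-sym xy)
      both (there (here refl)) (there (here e)) = contradiction (sym e) x≢y

-- Quadrangles

-- A quadrangular face with boundary e₀ e₁ e₂ e₃, and the remaining edge at each of its corners:
-- pa and pc at the black corners (e₃ , e₀) and (e₁ , e₂), pb and pd at the white ones (e₀ , e₁) and (e₂ , e₃).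
record Quad {E : Set} (L : List E) (β ω : E → E) (e₀ e₁ e₂ e₃ : E) : Set where
  field
    pa pb pc pd : E
    ω₁ : Cycle₃ ω e₀ e₁ pb
    ω₂ : Cycle₃ ω e₂ e₃ pd
    β₁ : Cycle₃ β e₃ e₀ pa
    β₂ : Cycle₃ β e₁ e₂ pc
    distinct : Unique (pa ∷ pc ∷ pb ∷ pd ∷ e₀ ∷ e₁ ∷ e₂ ∷ e₃ ∷ [])
    e₀∈ : e₀ ∈ L
    e₁∈ : e₁ ∈ L
    e₂∈ : e₂ ∈ L
    e₃∈ : e₃ ∈ L
    pa∈ : pa ∈ L
    pb∈ : pb ∈ L
    pc∈ : pc ∈ L
    pd∈ : pd ∈ L

-- Exchanging the colours shifts the boundary by one edge, so the reduction of the result pairs the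
-- outer edges along `e₁` and `e₃` instead of `e₀` and `e₂`.
quad-swap : ∀ {E : Set} {L : List E} {β ω e₀ e₁ e₂ e₃} → Quad L β ω e₀ e₁ e₂ e₃ → Quad L ω β e₁ e₂ e₃ e₀
quad-swap Q = record
  { pa = pb ; pb = pc ; pc = pd ; pd = pa ; ω₁ = β₂ ; ω₂ = β₁ ; β₁ = ω₁ ; β₂ = ω₂ ; distinct = distinct′ distinct
  ; e₀∈ = e₁∈ ; e₁∈ = e₂∈ ; e₂∈ = e₃∈ ; e₃∈ = e₀∈ ; pa∈ = pb∈ ; pb∈ = pc∈ ; pc∈ = pd∈ ; pd∈ = pa∈ }
  where
  open Quad Q
  distinct′ : ∀ {a c b d x y z w : _} → Unique (a ∷ c ∷ b ∷ d ∷ x ∷ y ∷ z ∷ w ∷ []) → Unique (b ∷ d ∷ c ∷ a ∷ y ∷ z ∷ w ∷ x ∷ [])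
  distinct′ ((ac ∷ ab ∷ ad ∷ ax ∷ ay ∷ az ∷ aw ∷ []) ∷ (cb ∷ cd ∷ cx ∷ cy ∷ cz ∷ cw ∷ []) ∷ (bd ∷ bx ∷ by ∷ bz ∷ bw ∷ []) ∷
             (dx ∷ dy ∷ dz ∷ dw ∷ []) ∷ (xy ∷ xz ∷ xw ∷ []) ∷ (yz ∷ yw ∷ []) ∷ (zw ∷ []) ∷ [] ∷ []) =
    (bd ∷ ≢-sym cb ∷ ≢-sym ab ∷ by ∷ bz ∷ bw ∷ bx ∷ []) ∷ (≢-sym cd ∷ ≢-sym ad ∷ dy ∷ dz ∷ dw ∷ dx ∷ []) ∷
    (≢-sym ac ∷ cy ∷ cz ∷ cw ∷ cx ∷ []) ∷ (ay ∷ az ∷ aw ∷ ax ∷ []) ∷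
    (yz ∷ yw ∷ ≢-sym xy ∷ []) ∷ (zw ∷ ≢-sym xz ∷ []) ∷ (≢-sym xw ∷ []) ∷ [] ∷ []

-- Outer edges at corners of the same colour differ because the corners do. Corners of different
-- colours are joined by a side, and a common outer edge would form a digon with that side.
quad-of : ∀ {E : Set} {L : List E} {β ω e₀} → Triad L β → Triad L ω → (∀ {y} → y ∈ L → β (ω y) ≢ y) → e₀ ∈ L →
          β (ω (β (ω e₀))) ≡ e₀ → Quad L β ω e₀ (ω e₀) (β (ω e₀)) (ω (β (ω e₀)))
quad-of {L = L} {β} {ω} {e₀} Tβ Tω noDigon e₀∈ period = record
  { pa = pa ; pb = pb ; pc = pc ; pd = pd
  ; ω₁ = triad-cycle Tω e₀∈ ; ω₂ = triad-cycle Tω e₂∈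
  ; β₁ = cycle₃ period refl βpa ; β₂ = triad-cycle Tβ e₁∈
  ; distinct =
      ((e₀≢e₂ ∘ Β.injective e₀∈ e₂∈) ∷ pa≢pb ∷ pa≢pd ∷ Β.free e₀∈ ∷ pa≢e₁ ∷ (e₀≢e₁ ∘ Β.injective e₀∈ e₁∈) ∷ pa≢e₃ ∷ []) ∷
      (pc≢pb ∷ pc≢pd ∷ pc≢e₀ ∷ Β.free² e₁∈ ∷ Β.free e₂∈ ∷ pc≢e₃ ∷ []) ∷
      ((e₁≢e₃ ∘ Ω.injective e₁∈ e₃∈) ∷ Ω.free² e₀∈ ∷ Ω.free e₁∈ ∷ pb≢e₂ ∷ (e₁≢e₂ ∘ Ω.injective e₁∈ e₂∈) ∷ []) ∷
      (pd≢e₀ ∷ (≢-sym e₀≢e₃ ∘ Ω.injective e₃∈ e₀∈) ∷ Ω.free² e₂∈ ∷ Ω.free e₃∈ ∷ []) ∷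
      (e₀≢e₁ ∷ e₀≢e₂ ∷ e₀≢e₃ ∷ []) ∷ (e₁≢e₂ ∷ e₁≢e₃ ∷ []) ∷ (≢-sym (Ω.free e₂∈) ∷ []) ∷ [] ∷ []
  ; e₀∈ = e₀∈ ; e₁∈ = e₁∈ ; e₂∈ = e₂∈ ; e₃∈ = e₃∈
  ; pa∈ = Β.closed e₀∈ ; pb∈ = Ω.closed e₁∈ ; pc∈ = Β.closed e₂∈ ; pd∈ = Ω.closed e₃∈ }
  where
  module Β = Triad Tβ
  module Ω = Triad Tω
  e₁ = ω e₀
  e₂ = β e₁
  e₃ = ω e₂
  pa = β e₀
  pb = ω e₁
  pc = β e₂
  pd = ω e₃
  e₁∈ = Ω.closed e₀∈
  e₂∈ = Β.closed e₁∈
  e₃∈ = Ω.closed e₂∈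
  βpa : β pa ≡ e₃
  βpa = trans (cong (λ z → β (β z)) (sym period)) (Β.cube e₃∈)
  βpc : β pc ≡ e₁
  βpc = Β.cube e₁∈
  ωpb : ω pb ≡ e₀
  ωpb = Ω.cube e₀∈
  ωpd : ω pd ≡ e₂
  ωpd = Ω.cube e₂∈
  e₀≢e₁ : e₀ ≢ e₁
  e₀≢e₁ = ≢-sym (Ω.free e₀∈)
  e₁≢e₂ : e₁ ≢ e₂
  e₁≢e₂ = ≢-sym (Β.free e₁∈)
  e₀≢e₃ : e₀ ≢ e₃
  e₀≢e₃ eq = Β.free e₃∈ (trans period eq)
  e₀≢e₂ : e₀ ≢ e₂
  e₀≢e₂ = ≢-sym (noDigon e₀∈)
  e₁≢e₃ : e₁ ≢ e₃
  e₁≢e₃ = e₀≢e₂ ∘ Ω.injective e₀∈ e₂∈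
  pa≢pb : pa ≢ pb
  pa≢pb eq = noDigon (Ω.closed e₁∈) (trans (cong β ωpb) eq)
  pc≢pd : pc ≢ pd
  pc≢pd eq = noDigon (Ω.closed e₃∈) (trans (cong β ωpd) eq)
  pa≢pd : pa ≢ pd
  pa≢pd eq = noDigon e₃∈ (trans (cong β (sym eq)) βpa)
  pc≢pb : pc ≢ pb
  pc≢pb eq = noDigon e₁∈ (trans (cong β (sym eq)) βpc)
  pa≢e₁ : pa ≢ e₁
  pa≢e₁ eq = Ω.free e₂∈ (sym (trans (cong β (sym eq)) βpa))
  pa≢e₃ : pa ≢ e₃
  pa≢e₃ eq = Β.free (Β.closed e₀∈) (trans βpa (sym eq))
  pc≢e₀ : pc ≢ e₀
  pc≢e₀ eq = Ω.free e₂∈ (Β.injective e₃∈ e₂∈ (trans period (sym eq)))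
  pc≢e₃ : pc ≢ e₃
  pc≢e₃ eq = e₀≢e₁ (trans (sym period) (trans (cong β (sym eq)) βpc))
  pb≢e₂ : pb ≢ e₂
  pb≢e₂ eq = e₀≢e₃ (trans (sym ωpb) (cong ω eq))
  pd≢e₀ : pd ≢ e₀
  pd≢e₀ eq = e₁≢e₂ (trans (cong ω (sym eq)) ωpd)

-- `σ` makes `pa` run from its own white end to the outer black end of `pb`, and `pc` from its own
-- white end to that of `pd`: the outer edges are paired along `e₀` and `e₂`. The sides together
-- with `pb` and `pd` close up and are dropped.
module QuadReduction {E K : Set} (_≟_ : DecidableEquality E) (_≟ᴷ_ : DecidableEquality K)
  {L : List E} {β ω : E → E} (M : PlanarMap K L β ω) {e₀ e₁ e₂ e₃ : E} (Q : Quad L β ω e₀ e₁ e₂ e₃) where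

  open DecMembership _≟_ using (_∈?_)
  open PlanarMap M
  open Quad Q
  open Cycle₃
  private
    module Φ = FaceLabelling faces

  D : List E
  D = pb ∷ pd ∷ e₀ ∷ e₁ ∷ e₂ ∷ e₃ ∷ []

  P : List E
  P = pa ∷ pc ∷ pb ∷ pd ∷ []

  uD : Unique D
  uD = Unique.drop⁺ 2 distinct

  pairs : List (E × E)
  pairs = (pa , pb) ∷ (pc , pd) ∷ (pb , pa) ∷ (pd , pc) ∷ []

  σ : E → E
  σ = assign _≟_ pairs id

  private
    uP : Unique P
    uP = Unique.take⁺ 4 distinct

  σpa : σ pa ≡ pb
  σpa = assign-∈ _≟_ pairs uP (here refl)

  σpc : σ pc ≡ pd
  σpc = assign-∈ _≟_ pairs uP (there (here refl))

  σpb : σ pb ≡ pa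
  σpb = assign-∈ _≟_ pairs uP (there (there (here refl)))

  σpd : σ pd ≡ pc
  σpd = assign-∈ _≟_ pairs uP (there (there (there (here refl))))

  σ-fix : ∀ {z} → z ∉ P → σ z ≡ z
  σ-fix = assign-∉ _≟_ pairs

  σe : ∀ {z} → z ∈ e₀ ∷ e₁ ∷ e₂ ∷ e₃ ∷ [] → σ z ≡ z
  σe z∈ = σ-fix (unique-++⁻ P distinct z∈)

  σ-elim : (R : E → E → Set) → R pa pb → R pb pa → R pc pd → R pd pc → (∀ z → R z z) → ∀ z → R z (σ z)
  σ-elim R ab ba cd dc same z with z ∈? P
  ... | yes (here refl) = subst (R z) (sym σpa) ab
  ... | yes (there (here refl)) = subst (R z) (sym σpc) cd
  ... | yes (there (there (here refl))) = subst (R z) (sym σpb) ba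
  ... | yes (there (there (there (here refl)))) = subst (R z) (sym σpd) dc
  ... | no z∉ = subst (R z) (sym (σ-fix z∉)) (same z)

  σσ : ∀ z → σ (σ z) ≡ z
  σσ z = σ-elim (λ z w → σ z ≡ w → σ w ≡ z) (λ _ → σpb) (λ _ → σpa) (λ _ → σpd) (λ _ → σpc) (λ _ → id) z refl

  σ∈ : ∀ {z} → z ∈ L → σ z ∈ L
  σ∈ {z} = σ-elim (λ z w → z ∈ L → w ∈ L) (λ _ → pb∈) (λ _ → pa∈) (λ _ → pd∈) (λ _ → pc∈) (λ _ → id) z

  private
    pattern 0th e = here e
    pattern 1st e = there (here e)
    pattern 2nd e = there (there (here e))
    pattern 3rd e = there (there (there (here e)))
    pattern 4th e = there (there (there (there (here e))))
    pattern 5th e = there (there (there (there (there (here e)))))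

    Eβ₁ Eβ₂ Eω₁ Eω₂ : List E
    Eβ₁ = e₃ ∷ e₀ ∷ pb ∷ []
    Eβ₂ = e₁ ∷ e₂ ∷ pd ∷ []
    Eω₁ = e₀ ∷ e₁ ∷ pb ∷ []
    Eω₂ = e₂ ∷ e₃ ∷ pd ∷ []

    D⇒β : ∀ {z} → z ∈ D → z ∈ Eβ₁ ⊎ z ∈ Eβ₂
    D⇒β (0th e) = inj₁ (2nd e)
    D⇒β (1st e) = inj₂ (2nd e)
    D⇒β (2nd e) = inj₁ (1st e)
    D⇒β (3rd e) = inj₂ (0th e)
    D⇒β (4th e) = inj₂ (1st e)
    D⇒β (5th e) = inj₁ (0th e)

    D⇒ω : ∀ {z} → z ∈ D → z ∈ Eω₁ ⊎ z ∈ Eω₂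
    D⇒ω (0th e) = inj₁ (2nd e)
    D⇒ω (1st e) = inj₂ (2nd e)
    D⇒ω (2nd e) = inj₁ (0th e)
    D⇒ω (3rd e) = inj₁ (1st e)
    D⇒ω (4th e) = inj₂ (0th e)
    D⇒ω (5th e) = inj₂ (1st e)

    β₁⇒D : ∀ {z} → z ∈ Eβ₁ → z ∈ D
    β₁⇒D (0th e) = 5th e
    β₁⇒D (1st e) = 2nd e
    β₁⇒D (2nd e) = 0th e

    β₂⇒D : ∀ {z} → z ∈ Eβ₂ → z ∈ D
    β₂⇒D (0th e) = 3rd e
    β₂⇒D (1st e) = 4th e
    β₂⇒D (2nd e) = 1st e

    ω₁⇒D : ∀ {z} → z ∈ Eω₁ → z ∈ D
    ω₁⇒D (0th e) = 2nd e
    ω₁⇒D (1st e) = 3rd e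
    ω₁⇒D (2nd e) = 0th e

    ω₂⇒D : ∀ {z} → z ∈ Eω₂ → z ∈ D
    ω₂⇒D (0th e) = 4th e
    ω₂⇒D (1st e) = 5th e
    ω₂⇒D (2nd e) = 1st e

  cycleβ₁ : Cycle₃ (λ z → σ (β (σ z))) e₃ e₀ pb
  cycleβ₁ = cycle₃ (trans (cong (σ ∘ β) (σe (3rd refl))) (trans (cong σ (a→b β₁)) (σe (0th refl))))
                   (trans (cong (σ ∘ β) (σe (0th refl))) (trans (cong σ (b→c β₁)) σpa))
                   (trans (cong (σ ∘ β) σpb) (trans (cong σ (c→a β₁)) (σe (3rd refl))))

  cycleβ₂ : Cycle₃ (λ z → σ (β (σ z))) e₁ e₂ pd
  cycleβ₂ = cycle₃ (trans (cong (σ ∘ β) (σe (1st refl))) (trans (cong σ (a→b β₂)) (σe (2nd refl))))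
                   (trans (cong (σ ∘ β) (σe (2nd refl))) (trans (cong σ (b→c β₂)) σpc))
                   (trans (cong (σ ∘ β) σpd) (trans (cong σ (c→a β₂)) (σe (1st refl))))

  D⊆L : ∀ {z} → z ∈ D → z ∈ L
  D⊆L (0th refl) = pb∈
  D⊆L (1st refl) = pd∈
  D⊆L (2nd refl) = e₀∈
  D⊆L (3rd refl) = e₁∈
  D⊆L (4th refl) = e₂∈
  D⊆L (5th refl) = e₃∈

  open Reduction _≟_ uL Tβ Tω σ σσ σ∈ uD D⊆L
    (λ z∈ → [ β₁⇒D ∘ cycle₃-closed cycleβ₁ , β₂⇒D ∘ cycle₃-closed cycleβ₂ ]′ (D⇒β z∈))
    (λ z∈ → [ ω₁⇒D ∘ cycle₃-closed ω₁ , ω₂⇒D ∘ cycle₃-closed ω₂ ]′ (D⇒ω z∈))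
    public renaming (connected to reduce-connected; faces to reduce-faces)

  pa∈′ : pa ∈ L′
  pa∈′ = ∈-∖⁺ _≟_ pa∈ (Unique.Unique[x∷xs]⇒x∉xs distinct ∘ there)

  pc∈′ : pc ∈ L′
  pc∈′ = ∈-∖⁺ _≟_ pc∈ (Unique.Unique[x∷xs]⇒x∉xs (Unique.drop⁺ 1 distinct))

  σ-fix′ : ∀ {z} → z ∈ L′ → z ≢ pa → z ≢ pc → σ z ≡ z
  σ-fix′ z∈ z≢a z≢c = σ-fix λ
    { (0th e) → z≢a e ; (1st e) → z≢c e ; (2nd e) → proj₂ (split z∈) (0th e) ; (3rd e) → proj₂ (split z∈) (1st e) }

  connected′ : Conn (_∈ L′) β′ ω pa pc → ConnectedMap L′ β′ ω
  connected′ pa~pc = reduce-connected pa∈′ near conn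
    where
    near : ∀ {z} → z ∈ L′ → σ z ≡ z ⊎ Conn (_∈ L′) β′ ω z pa
    near {z} z∈ with z ≟ pa | z ≟ pc
    ... | yes refl | _ = inj₂ ε
    ... | no _ | yes refl = inj₂ (conn-sym pa~pc)
    ... | no z≢a | no z≢c = inj₁ (σ-fix′ z∈ z≢a z≢c)

  private
    label-ab : Φ.label pa ≡ Φ.label pb
    label-ab = trans (cong Φ.label (sym (trans (cong β (c→a ω₁)) (b→c β₁)))) (Φ.invariant pb∈)

    label-cd : Φ.label pc ≡ Φ.label pd
    label-cd = trans (cong Φ.label (sym (trans (cong β (c→a ω₂)) (b→c β₂)))) (Φ.invariant pd∈)

    -- `pa` and `pb` carry the label of the face across `e₀`, and `pc` and `pd` that of the face
    -- across `e₂`.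
    label-σ : ∀ z → Φ.label (σ z) ≡ Φ.label z
    label-σ = σ-elim (λ z w → Φ.label w ≡ Φ.label z) (sym label-ab) label-ab (sym label-cd) label-cd (λ _ → refl)

    label-β′pa : Φ.label (β′ pa) ≡ Φ.label e₁
    label-β′pa = trans (label-σ _) (trans (cong (Φ.label ∘ β) (trans σpa (sym (b→c ω₁)))) (Φ.invariant e₁∈))

    label-β′pc : Φ.label (β′ pc) ≡ Φ.label e₃
    label-β′pc = trans (label-σ _) (trans (cong (Φ.label ∘ β) (trans σpc (sym (b→c ω₂)))) (Φ.invariant e₃∈))

    -- Pairing along `e₀` and `e₂` opens the quadrangle to the faces across `e₁` and `e₃`. Three
    -- faces become one, which costs the two names in `lost`.
    merge : K → K
    merge = assign _≟ᴷ_ ((Φ.label e₃ , Φ.label e₁) ∷ []) id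

    merge-e₃ : merge (Φ.label e₃) ≡ Φ.label e₁
    merge-e₃ = assign-∈ _≟ᴷ_ _ ([] ∷ []) (here refl)

    merge-keep : ∀ {k} → k ≢ Φ.label e₃ → merge k ≡ k
    merge-keep k≢ = assign-∉ _≟ᴷ_ _ λ { (here e) → k≢ e }

    merge-e₁ : merge (Φ.label e₁) ≡ Φ.label e₁
    merge-e₁ with Φ.label e₁ ≟ᴷ Φ.label e₃
    ... | yes e = trans (cong merge e) merge-e₃
    ... | no n = merge-keep n

  reduced : ConnectedMap L′ β′ ω → PlanarMap K L′ β′ ω
  reduced conn′ = record
    { uL = uL′ ; Tβ = Tβ′ ; Tω = Tω′ ; conn = conn′
    ; faces = reduce-faces _≟ᴷ_ faces lost ℕ.≤-refl (merge ∘ Φ.label) (λ k∉ → merge-keep (k∉ ∘ there ∘ here)) inv rehit }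
    where
    lost = Φ.label e₀ ∷ Φ.label e₃ ∷ []
    inv : ∀ {z} → z ∈ L′ → merge (Φ.label (β′ (ω z))) ≡ merge (Φ.label z)
    inv {z} z∈ with ω z ≟ pa | ω z ≟ pc
    -- After `pa` the old face went on to `e₃`; the new one goes on to `β′ pa`, which is labelled
    -- like `e₁`. For `pc` the roles of `e₁` and `e₃` are interchanged.
    ... | yes eq | _ = trans (cong (merge ∘ Φ.label ∘ β′) eq) (trans (cong merge label-β′pa) (trans merge-e₁ (trans (sym merge-e₃)
            (cong merge (trans (cong Φ.label (sym (trans (cong β eq) (c→a β₁)))) (Φ.invariant (proj₁ (split z∈))))))))
    ... | no _ | yes eq = trans (cong (merge ∘ Φ.label ∘ β′) eq) (trans (cong merge label-β′pc) (trans merge-e₃ (trans (sym merge-e₁)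
            (cong merge (trans (cong Φ.label (sym (trans (cong β eq) (c→a β₂)))) (Φ.invariant (proj₁ (split z∈))))))))
    ... | no ≢a | no ≢c = cong merge (trans (label-σ _)
            (trans (cong (Φ.label ∘ β) (σ-fix′ (Triad.closed Tω′ z∈) ≢a ≢c)) (Φ.invariant (proj₁ (split z∈)))))
    rehit : ∀ {z} → z ∈ D → Φ.label z ∈ lost ⊎ ∃[ w ] (w ∈ L′ × Φ.label w ≡ Φ.label z)
    rehit (0th refl) = inj₂ (pa , pa∈′ , label-ab)
    rehit (1st refl) = inj₂ (pc , pc∈′ , label-cd)
    rehit (2nd refl) = inj₁ (here refl)
    rehit (3rd refl) = inj₂ (β′ pa , Triad.closed Tβ′ pa∈′ , label-β′pa)
    rehit (4th refl) = inj₁ (here (trans (cong Φ.label (sym (trans (cong β (a→b ω₁)) (a→b β₂)))) (Φ.invariant e₀∈)))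
    rehit (5th refl) = inj₁ (there (here refl))

  -- A path of the reduced 2-factor through a new edge is rerouted along one side of the
  -- quadrangle if both new edges are used, and along three sides if only one is.
  module _ {s′ t′ : E} (S′ : Solution L′ β′ ω s′ t′) where

    private
      module S′ = Solution S′
      fa fc : Bool
      fa = S′.F pa
      fc = S′.F pc

      _⇒_ : Bool → Bool → Bool
      true ⇒ c = c
      false ⇒ _ = true

      -- If both new edges are used, `e₁` and `e₃` would satisfy the corners as well, but only `e₀`
      -- and `e₂` join `pa` to `pb` and `pc` to `pd`. If neither is used, all four sides are forced
      -- in and form a cycle.
      values : List (E × Bool)
      values = (pb , fa) ∷ (pd , fc) ∷ (e₀ , fa ⇒ fc) ∷ (e₁ , not (fa ∧ fc)) ∷ (e₂ , fc ⇒ fa) ∷ (e₃ , not (fa ∧ fc)) ∷ []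

    F : E → Bool
    F = assign _≟_ values S′.F

    private
      F-live : ∀ {z} → z ∈ L′ → F z ≡ S′.F z
      F-live z∈ = assign-∉ _≟_ values (proj₂ (split z∈))

      Fpb : F pb ≡ fa
      Fpb = assign-∈ _≟_ values uD (0th refl)
      Fpd : F pd ≡ fc
      Fpd = assign-∈ _≟_ values uD (1st refl)
      Fe₀ : F e₀ ≡ fa ⇒ fc
      Fe₀ = assign-∈ _≟_ values uD (2nd refl)
      Fe₁ : F e₁ ≡ not (fa ∧ fc)
      Fe₁ = assign-∈ _≟_ values uD (3rd refl)
      Fe₂ : F e₂ ≡ fc ⇒ fa
      Fe₂ = assign-∈ _≟_ values uD (4th refl)
      Fe₃ : F e₃ ≡ not (fa ∧ fc)
      Fe₃ = assign-∈ _≟_ values uD (5th refl)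

      corner₁ : ∀ a c → OneFalse (not (a ∧ c)) (a ⇒ c) a
      corner₁ true true = first
      corner₁ true false = second
      corner₁ false _ = third

      corner₂ : ∀ a c → OneFalse (not (a ∧ c)) (c ⇒ a) c
      corner₂ true true = first
      corner₂ true false = third
      corner₂ false true = second
      corner₂ false false = third

      oβ₁ : OneFalse (F e₃) (F e₀) (F pb)
      oβ₁ rewrite Fe₃ | Fe₀ | Fpb = corner₁ fa fc
      oβ₂ : OneFalse (F e₁) (F e₂) (F pd)
      oβ₂ rewrite Fe₁ | Fe₂ | Fpd = corner₂ fa fc
      oω₁ : OneFalse (F e₀) (F e₁) (F pb)
      oω₁ rewrite Fe₀ | Fe₁ | Fpb = exchange (corner₁ fa fc)
      oω₂ : OneFalse (F e₂) (F e₃) (F pd)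
      oω₂ rewrite Fe₂ | Fe₃ | Fpd = exchange (corner₂ fa fc)

      F-σ : ∀ z → F (σ z) ≡ F z
      F-σ = σ-elim (λ z w → F w ≡ F z) (trans Fpb (sym (F-live pa∈′))) (trans (F-live pa∈′) (sym Fpb))
                   (trans Fpd (sym (F-live pc∈′))) (trans (F-live pc∈′) (sym Fpd)) (λ _ → refl)

      _~_ : E → E → Set
      _~_ = Conn (In L F) β ω

      link-ab : ∀ a c → fa ≡ a → fc ≡ c → a ≡ true → pa ~ pb
      link-ab true true eqA eqC refl = β← i₀ ia (b→c β₁) ◅◅ ω← ib i₀ (c→a ω₁)
        where
        ia = pa∈ , trans (F-live pa∈′) eqA
        ib = pb∈ , trans Fpb eqA
        i₀ = e₀∈ , trans Fe₀ (cong₂ _⇒_ eqA eqC)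
      link-ab true false eqA eqC refl = β→ ia i₃ (c→a β₁) ◅◅ ω← i₂ i₃ (a→b ω₂) ◅◅ β← i₁ i₂ (a→b β₂) ◅◅ ω→ i₁ ib (b→c ω₁)
        where
        ia = pa∈ , trans (F-live pa∈′) eqA
        ib = pb∈ , trans Fpb eqA
        i₁ = e₁∈ , trans Fe₁ (cong₂ (λ a c → not (a ∧ c)) eqA eqC)
        i₂ = e₂∈ , trans Fe₂ (cong₂ _⇒_ eqC eqA)
        i₃ = e₃∈ , trans Fe₃ (cong₂ (λ a c → not (a ∧ c)) eqA eqC)

      link-cd : ∀ a c → fa ≡ a → fc ≡ c → c ≡ true → pc ~ pd
      link-cd true true eqA eqC refl = β← i₂ ic (b→c β₂) ◅◅ ω← id′ i₂ (c→a ω₂)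
        where
        ic = pc∈ , trans (F-live pc∈′) eqC
        id′ = pd∈ , trans Fpd eqC
        i₂ = e₂∈ , trans Fe₂ (cong₂ _⇒_ eqC eqA)
      link-cd false true eqA eqC refl = β→ ic i₁ (c→a β₂) ◅◅ ω← i₀ i₁ (a→b ω₁) ◅◅ β← i₃ i₀ (a→b β₁) ◅◅ ω→ i₃ id′ (b→c ω₂)
        where
        ic = pc∈ , trans (F-live pc∈′) eqC
        id′ = pd∈ , trans Fpd eqC
        i₀ = e₀∈ , trans Fe₀ (cong₂ _⇒_ eqA eqC)
        i₁ = e₁∈ , trans Fe₁ (cong₂ (λ a c → not (a ∧ c)) eqA eqC)
        i₃ = e₃∈ , trans Fe₃ (cong₂ (λ a c → not (a ∧ c)) eqA eqC)

      link : ∀ {z} → z ∈ L′ → F z ≡ true → z ~ σ z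
      link {z} z∈ Fz with z ≟ pa | z ≟ pc
      ... | yes refl | _ = subst (z ~_) (sym σpa) (link-ab fa fc refl refl (trans (sym (F-live pa∈′)) Fz))
      ... | no _ | yes refl = subst (z ~_) (sym σpc) (link-cd fa fc refl refl (trans (sym (F-live pc∈′)) Fz))
      ... | no ≢a | no ≢c = conn-reflexive (sym (σ-fix′ z∈ ≢a ≢c))

    open Lift S′ F F-live F-σ
      (λ z∈ → [ cycle₃-oneFalse F cycleβ₁ oβ₁ , cycle₃-oneFalse F cycleβ₂ oβ₂ ]′ (D⇒β z∈))
      (λ z∈ → [ cycle₃-oneFalse F ω₁ oω₁ , cycle₃-oneFalse F ω₂ oω₂ ]′ (D⇒ω z∈)) link public

  private
    home : ∀ {s} → s ∈ L → s ∉ e₀ ∷ e₁ ∷ e₂ ∷ e₃ ∷ [] → ∃[ z ] (z ∈ L′ × (s ≡ z ⊎ s ≡ σ z))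
    home {s} s∈ s∉ with s ∈? D
    ... | no s∉D = s , ∈-∖⁺ _≟_ s∈ s∉D , inj₁ refl
    ... | yes (0th refl) = pa , pa∈′ , inj₂ (sym σpa)
    ... | yes (1st refl) = pc , pc∈′ , inj₂ (sym σpc)
    ... | yes (there (there s∈e)) = contradiction s∈e s∉

  solve-quad : (∀ {s′ t′} → s′ ∈ L′ → t′ ∈ L′ → Solution L′ β′ ω s′ t′) → ∀ {s t} → s ∈ L → t ∈ L →
               s ∉ e₀ ∷ e₁ ∷ e₂ ∷ e₃ ∷ [] → t ∉ e₀ ∷ e₁ ∷ e₂ ∷ e₃ ∷ [] → Solution L β ω s t
  solve-quad ih s∈ t∈ s∉ t∉ with home s∈ s∉ | home t∈ t∉
  ... | s′ , s′∈ , hs | t′ , t′∈ , ht = solution-attached S′ (attach S′ s′∈ (Solution.s∈F S′) hs) (attach S′ t′∈ (Solution.t∈F S′) ht)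
    where S′ = ih s′∈ t′∈

-- The induction

module _ {E K : Set} (_≟_ : DecidableEquality E) (_≟ᴷ_ : DecidableEquality K) where

  open DecMembership _≟_ using (_∈?_)

  -- If the first way of reconnecting the four outer edges disconnects the graph, then
  -- bridgelessness joins the outer ends of pa and pb off the quadrangle, so the other way does not.
  quad-connected : ∀ {L : List E} {β ω e₀ e₁ e₂ e₃} (M : PlanarMap K L β ω) (Q : Quad L β ω e₀ e₁ e₂ e₃) →
    let module Q₁ = QuadReduction _≟_ _≟ᴷ_ M Q
        module Q₂ = QuadReduction _≟_ _≟ᴷ_ (planarMap-swap M) (quad-swap Q)
    in ConnectedMap Q₁.L′ Q₁.β′ ω ⊎ ConnectedMap Q₂.L′ Q₂.β′ β
  quad-connected {L} {β} {ω} {e₀} {e₁} {e₂} {e₃} M Q = decide (pc ∈? H)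
    where
    open Quad Q
    module Q₁ = QuadReduction _≟_ _≟ᴷ_ M Q
    module Q₂ = QuadReduction _≟_ _≟ᴷ_ (planarMap-swap M) (quad-swap Q)
    open Component (component _≟_ Q₁.uL′ Q₁.Tβ′ Q₁.Tω′ Q₁.pa∈′)
    _~_ : E → E → Set
    _~_ = Conn (_∈ Q₂.L′) Q₂.β′ β
    decide : Dec (pc ∈ H) → ConnectedMap Q₁.L′ Q₁.β′ ω ⊎ ConnectedMap Q₂.L′ Q₂.β′ β
    decide (yes pc∈H) = inj₁ (Q₁.connected′ (reach pc∈H))
    decide (no pc∉H) = inj₂ (Q₂.connected′ pb~pd)
      where
      -- As `pc` is not in `H`, both involutions fix the edges of `H` other than `pa` and both
      -- reductions keep them; a path through such edges is valid in either reduced map.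
      Far : E → Set
      Far x = x ∈ H × x ≢ pa
      σ₁-fix : ∀ {x} → Far x → Q₁.σ x ≡ x
      σ₁-fix (x∈ , x≢a) = Q₁.σ-fix′ (sub x∈) x≢a λ { refl → pc∉H x∈ }
      far-live : ∀ {x} → Far x → x ∈ Q₂.L′
      far-live (x∈ , x≢a) = ∈-∖⁺ _≟_ (proj₁ (Q₁.split (sub x∈))) λ
        { (here refl) → pc∉H x∈ ; (there (here e)) → x≢a e
        ; (there (there (here e))) → dead (there (there (there (here e))))
        ; (there (there (there (here e)))) → dead (there (there (there (there (here e)))))
        ; (there (there (there (there (here e))))) → dead (there (there (there (there (there (here e))))))
        ; (there (there (there (there (there (here e)))))) → dead (there (there (here e))) }
        where dead = proj₂ (Q₁.split (sub x∈))
      σ₂-fix : ∀ {x} → Far x → Q₂.σ x ≡ x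
      σ₂-fix far@(x∈ , _) = Q₂.σ-fix′ (far-live far) (λ e → dead (here e)) (λ e → dead (there (here e)))
        where dead = proj₂ (Q₁.split (sub x∈))
      step : ∀ {x y} → Step Far Q₁.β′ ω x y → Step (_∈ Q₂.L′) Q₂.β′ β x y
      step {x} {y} (via-β fx fy e) = via-ω (far-live fx) (far-live fy)
        (trans (cong β (sym (σ₁-fix fx))) (trans (sym (Q₁.σσ _)) (trans (cong Q₁.σ e) (σ₁-fix fy))))
      step {x} {y} (via-ω fx fy e) = via-β (far-live fx) (far-live fy)
        (trans (cong (Q₂.σ ∘ ω) (σ₂-fix fx)) (trans (cong Q₂.σ e) (σ₂-fix fy)))
      Tβ″ : Triad H Q₁.β′
      Tβ″ = triad-restrict Q₁.Tβ′ sub β∈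
      Tω″ : Triad H ω
      Tω″ = triad-restrict Q₁.Tω′ sub ω∈
      ωpa : Far (ω pa)
      ωpa = ω∈ root , Triad.free Tω″ root
      β′pa : Far (Q₁.β′ pa)
      β′pa = β∈ root , Triad.free Tβ″ root
      pb~pd : pb ~ pd
      -- In the second reduction `pb` still meets `Q₁.β′ pa` at its black end, and `pd` takes over
      -- the white end of `pa`, where it meets `ω pa`. Bridgelessness of `H` at `pa` joins these two
      -- edges without passing through `pa`.
      pb~pd = ω→ Q₂.pa∈′ (far-live β′pa) (trans (cong β (sym Q₁.σpa)) (trans (sym (Q₁.σσ _)) (σ₁-fix β′pa)))
        ◅◅ conn-sym (EqC.map step (bridgeless _≟_ uniq Tβ″ Tω″ root))
        ◅◅ β← Q₂.pc∈′ (far-live ωpa) (trans (cong (Q₂.σ ∘ ω) Q₂.σpc) (σ₂-fix ωpa))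

  -- Counting edges by their labels

  module _ {L : List E} (label : E → K) where

    class : K → List E
    class k = filter (λ x → label x ≟ᴷ k) L

    ∈-class⁻ : ∀ {x} k → x ∈ class k → x ∈ L × label x ≡ k
    ∈-class⁻ k = ∈-filter⁻ (λ x → label x ≟ᴷ k)

    -- Classes of different labels are disjoint. This serves twice: with faces as labels in the
    -- search for a quadrangle, and with end vertices as labels in bounding the number of vertices.
    classes-length : Unique L → (w : K → ℕ) (ks : List K) → Unique ks → (∀ {k} → k ∈ ks → w k ≤ length (class k)) →
                     sum (map w ks) ≤ length L
    classes-length uL w ks uks big = ℕ.≤-trans (total ks big) (unique-⊆-length (uniq ks uks) (sub ks))
      where
      total : ∀ ks → (∀ {k} → k ∈ ks → w k ≤ length (class k)) → sum (map w ks) ≤ length (concatMap class ks)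
      total [] _ = z≤n
      total (k ∷ ks) big rewrite length-++ (class k) {concatMap class ks} = ℕ.+-mono-≤ (big (here refl)) (total ks (big ∘ there))
      owner : ∀ ks {x} → x ∈ concatMap class ks → label x ∈ ks × x ∈ L
      owner (k ∷ ks) x∈ with ∈-++⁻ (class k) x∈
      ... | inj₁ p = let x∈L , eq = ∈-class⁻ k p in here eq , x∈L
      ... | inj₂ p = let k∈ , x∈L = owner ks p in there k∈ , x∈L
      sub : ∀ ks {x} → x ∈ concatMap class ks → x ∈ L
      sub ks = proj₂ ∘ owner ks
      uniq : ∀ ks → Unique ks → Unique (concatMap class ks)
      uniq [] _ = []
      uniq (k ∷ ks) (k≢ ∷ u) = Unique.++⁺ (Unique.filter⁺ (λ x → label x ≟ᴷ k) uL) (uniq ks u)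
        λ (p , q) → All.lookup k≢ (proj₁ (owner ks q)) (sym (proj₂ (∈-class⁻ k p)))

  private
    module ∈ᴷ = DecMembership _≟ᴷ_

    -- The class size guaranteed when no quadrangle avoids `bad`: two for every label, as there are
    -- no digons, and three outside `bad`.
    weight : List K → K → ℕ
    weight bad k with k ∈ᴷ.∈? bad
    ... | yes _ = 2
    ... | no _ = 3

    sum-weight : ∀ bad {ks} → Unique ks → 3 * length ks ≤ length bad + sum (map (weight bad) ks)
    sum-weight bad {ks} u = ℕ.≤-trans (go ks)
        (ℕ.+-monoˡ-≤ _ (unique-⊆-length (Unique.filter⁺ (∈ᴷ._∈? bad) u) (proj₂ ∘ ∈-filter⁻ (∈ᴷ._∈? bad) {xs = ks})))
      where
      open ℕ.≤-Reasoning
      swap-+ : ∀ a b c → b + (a + c) ≡ a + (b + c)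
      swap-+ a b c = trans (sym (ℕ.+-assoc b a c)) (trans (cong (_+ c) (ℕ.+-comm b a)) (ℕ.+-assoc a b c))
      go : ∀ ks → 3 * length ks ≤ length (filter (∈ᴷ._∈? bad) ks) + sum (map (weight bad) ks)
      go [] = z≤n
      go (k ∷ ks) with k ∈ᴷ.∈? bad
      ... | yes _ = begin
        3 * suc (length ks)                                                             ≡⟨ ℕ.*-suc 3 (length ks) ⟩
        3 + 3 * length ks                                                               ≤⟨ ℕ.+-monoʳ-≤ 3 (go ks) ⟩
        1 + (2 + (length (filter (∈ᴷ._∈? bad) ks) + sum (map (weight bad) ks)))         ≡⟨ cong suc (swap-+ (length (filter (∈ᴷ._∈? bad) ks)) 2 _) ⟩
        1 + (length (filter (∈ᴷ._∈? bad) ks) + (2 + sum (map (weight bad) ks)))         ∎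
      ... | no _ = begin
        3 * suc (length ks)                                                             ≡⟨ ℕ.*-suc 3 (length ks) ⟩
        3 + 3 * length ks                                                               ≤⟨ ℕ.+-monoʳ-≤ 3 (go ks) ⟩
        3 + (length (filter (∈ᴷ._∈? bad) ks) + sum (map (weight bad) ks))               ≡⟨ swap-+ (length (filter (∈ᴷ._∈? bad) ks)) 3 _ ⟩
        length (filter (∈ᴷ._∈? bad) ks) + (3 + sum (map (weight bad) ks))               ∎

  -- By Euler's formula at least six labels are carried by just two edges; at most four labels
  -- belong to faces incident with s or t.
  find-quad : ∀ {L : List E} {β ω s t} → PlanarMap K L β ω → (∀ {y} → y ∈ L → β (ω y) ≢ y) → s ∈ L → t ∈ L →
    ∃[ e₀ ] (e₀ ∈ L × β (ω (β (ω e₀))) ≡ e₀ ×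
      let es = e₀ ∷ ω e₀ ∷ β (ω e₀) ∷ ω (β (ω e₀)) ∷ [] in s ∉ es × t ∉ es)
  find-quad {L} {β} {ω} {s} {t} M noDigon s∈ t∈ =
    decide (any? (λ k → ¬? (k ∈ᴷ.∈? bad) ×-dec (length (class {L} label k) ≤? 2)) names)
    where
    open PlanarMap M
    open FaceLabelling faces
    module Β = Triad Tβ
    module Ω = Triad Tω
    bad : List K
    -- An edge `x` has the face of `x` on one side and that of `ω (ω x)`, its predecessor at the
    -- white end, on the other.
    bad = label s ∷ label (ω (ω s)) ∷ label t ∷ label (ω (ω t)) ∷ []
    next∈ : ∀ {x} → x ∈ L → β (ω x) ∈ L
    next∈ = Β.closed ∘ Ω.closed
    ∈-class : ∀ {x} k → x ∈ L → label x ≡ k → x ∈ class {L} label k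
    ∈-class k = ∈-filter⁺ (λ x → label x ≟ᴷ k)
    Result : Set
    Result = ∃[ e₀ ] (e₀ ∈ L × β (ω (β (ω e₀))) ≡ e₀ ×
      let es = e₀ ∷ ω e₀ ∷ β (ω e₀) ∷ ω (β (ω e₀)) ∷ [] in s ∉ es × t ∉ es)
    decide : Dec (Any (λ k → k ∉ bad × length (class {L} label k) ≤ 2) names) → Result
    -- Otherwise every name outside `bad` is carried by at least three edges and every other name by
    -- at least two, so |L| + 6 ≤ 3 · |names| ≤ 4 + |L|.
    decide (no none) = contradiction (ℕ.≤-trans euler (ℕ.≤-trans (sum-weight bad unique)
        (ℕ.+-monoʳ-≤ 4 (classes-length label uL (weight bad) names unique big)))) λ le →
        contradiction (ℕ.+-cancelʳ-≤ (length L) 6 4 (subst (_≤ 4 + length L) (ℕ.+-comm (length L) 6) le)) λ { (s≤s (s≤s (s≤s (s≤s ())))) }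
      where
      big : ∀ {k} → k ∈ names → weight bad k ≤ length (class {L} label k)
      big {k} k∈ with k ∈ᴷ.∈? bad
      ... | no k∉ = ℕ.≰⇒> λ small → none (lose k∈ (k∉ , small))
      ... | yes _ with hit k∈
      ...   | x , x∈ , refl = unique-⊆-length {xs = x ∷ β (ω x) ∷ []} ((≢-sym (noDigon x∈) ∷ []) ∷ [] ∷ []) λ
        { (here refl) → ∈-class _ x∈ refl ; (there (here refl)) → ∈-class _ (next∈ x∈) (invariant x∈) }
    decide (yes some) with find some
    ... | k , k∈ , k∉bad , small with hit k∈
    ...   | z , z∈ , refl = z , z∈ , period , avoid s∈ (here refl) (there (here refl))
                                           , avoid t∈ (there (there (here refl))) (there (there (there (here refl))))
      where
      z₁ = β (ω z)
      z₂ = β (ω z₁)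
      z₁∈ = next∈ z∈
      -- The class of `z` contains its whole orbit, so an orbit of more than two elements would not
      -- fit.
      period : z₂ ≡ z
      period with z₂ ≟ z
      ... | yes eq = eq
      ... | no z₂≢z = contradiction (ℕ.≤-trans (unique-⊆-length {xs = z ∷ z₁ ∷ z₂ ∷ []}
          ((≢-sym (noDigon z∈) ∷ ≢-sym z₂≢z ∷ []) ∷ (≢-sym (noDigon z₁∈) ∷ []) ∷ [] ∷ []) λ
          { (here refl) → ∈-class _ z∈ refl ; (there (here refl)) → ∈-class _ z₁∈ (invariant z∈)
          ; (there (there (here refl))) → ∈-class _ (next∈ z₁∈) (trans (invariant z₁∈) (invariant z∈)) }) small)
          λ { (s≤s (s≤s ())) }
      avoid : ∀ {r} → r ∈ L → label r ∈ bad → label (ω (ω r)) ∈ bad → r ∉ z ∷ ω z ∷ z₁ ∷ ω z₁ ∷ []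
      avoid r∈ b b′ (here refl) = k∉bad b
      avoid r∈ b b′ (there (here refl)) = k∉bad (subst (_∈ bad) (cong label (Ω.cube z∈)) b′)
      avoid r∈ b b′ (there (there (here refl))) = k∉bad (subst (_∈ bad) (invariant z∈) b)
      avoid r∈ b b′ (there (there (there (here refl)))) = k∉bad (subst (_∈ bad) (trans (cong label (Ω.cube z₁∈)) (invariant z∈)) b′)

  -- `n` bounds the number of live edges. The recursion ends at the theta: any other map has a
  -- reducible digon or a suitable quadrangle.
  solve : ∀ n {L : List E} {β ω s t} → length L ≤ n → PlanarMap K L β ω → s ∈ L → t ∈ L → Solution L β ω s t
  solve zero {[]} _ _ ()
  solve (suc n) {L} {β} {ω} {s} {t} le M s∈ t∈ with any? (λ y → β (ω y) ≟ y) L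
  ... | yes some = digon (find some)
    where
    digon : ∃[ y ] (y ∈ L × β (ω y) ≡ y) → Solution L β ω s t
    digon (y , y∈ , fix) with β y ≟ ω (ω y)
    ... | yes p≡q = Digon.solve-theta _≟_ _≟ᴷ_ M y∈ fix p≡q s∈ t∈
    ... | no p≢q = R.solve-digon p≢q (solve n (ℕ.≤-pred (ℕ.≤-trans (ℕ.≤-trans (ℕ.+-monoˡ-≤ _ 1≤3) (R.shrink p≢q)) le)) (R.reduced p≢q)) s∈ t∈
      where
      module R = Digon _≟_ _≟ᴷ_ M y∈ fix
      1≤3 : 1 ≤ 3
      1≤3 = s≤s z≤n
  ... | no none = quad (find-quad M noDigon s∈ t∈)
    where
    open PlanarMap M
    noDigon : ∀ {y} → y ∈ L → β (ω y) ≢ y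
    noDigon y∈ eq = none (lose y∈ eq)
    1≤6 : 1 ≤ 6
    1≤6 = s≤s z≤n
    quad : ∃[ e₀ ] (e₀ ∈ L × β (ω (β (ω e₀))) ≡ e₀ ×
      let es = e₀ ∷ ω e₀ ∷ β (ω e₀) ∷ ω (β (ω e₀)) ∷ [] in s ∉ es × t ∉ es) → Solution L β ω s t
    quad (e₀ , e₀∈ , period , s∉ , t∉) = [ first-way , second-way ]′ (quad-connected M Q)
      where
      Q = quad-of Tβ Tω noDigon e₀∈ period
      module Q₁ = QuadReduction _≟_ _≟ᴷ_ M Q
      module Q₂ = QuadReduction _≟_ _≟ᴷ_ (planarMap-swap M) (quad-swap Q)
      turn : ∀ {r a b c d : E} → r ∉ a ∷ b ∷ c ∷ d ∷ [] → r ∉ b ∷ c ∷ d ∷ a ∷ []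
      turn r∉ (here e) = r∉ (there (here e))
      turn r∉ (there (here e)) = r∉ (there (there (here e)))
      turn r∉ (there (there (here e))) = r∉ (there (there (there (here e))))
      turn r∉ (there (there (there (here e)))) = r∉ (here e)
      first-way : ConnectedMap Q₁.L′ Q₁.β′ ω → Solution L β ω s t
      first-way c = Q₁.solve-quad (solve n (ℕ.≤-pred (ℕ.≤-trans (ℕ.≤-trans (ℕ.+-monoˡ-≤ _ 1≤6) Q₁.shrink) le)) (Q₁.reduced c)) s∈ t∈ s∉ t∉
      second-way : ConnectedMap Q₂.L′ Q₂.β′ β → Solution L β ω s t
      second-way c = solution-swap (Q₂.solve-quad
        (solve n (ℕ.≤-pred (ℕ.≤-trans (ℕ.≤-trans (ℕ.+-monoˡ-≤ _ 1≤6) Q₂.shrink) le)) (Q₂.reduced c)) s∈ t∈ (turn s∉) (turn t∉))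

-- From multigraphs to maps

oneFalse-length : ∀ {E : Set} (F : E → Bool) {a b c x y z} → F a ≡ x → F b ≡ y → F c ≡ z → OneFalse x y z →
                  length (filter (λ e → F e Bool.≟ true) (a ∷ b ∷ c ∷ [])) ≡ 2
oneFalse-length F p q r first rewrite p | q | r = refl
oneFalse-length F p q r second rewrite p | q | r = refl
oneFalse-length F p q r third rewrite p | q | r = refl

module Translate (G : Multigraph) (cubic : Cubic G) (bipartite : Bipartite G) (rotation : RotationSystem G) where

  open Multigraph G
  open RotationSystem rotation
  private
    _≟ᵉ_ : DecidableEquality (Fin m)
    _≟ᵉ_ = Fin._≟_
    colour = proj₁ bipartite
    proper = proj₂ bipartite

  dart : Bool → Fin m → Dart G
  dart k e = e , does (colour (src e) Bool.≟ k)

  end : Bool → Fin m → Fin n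
  end k e = head G (dart k e)

  tgt-colour : ∀ e → colour (tgt e) ≡ not (colour (src e))
  tgt-colour e = Bool.¬-not (≢-sym (proper e))

  end-colour : ∀ k e → colour (end k e) ≡ k
  end-colour k e with colour (src e) Bool.≟ k
  ... | yes eq = eq
  ... | no ≢k = trans (tgt-colour e) (sym (Bool.¬-not (≢-sym ≢k)))

  end-src : ∀ e → end (colour (src e)) e ≡ src e
  end-src e with colour (src e) Bool.≟ colour (src e)
  ... | yes _ = refl
  ... | no n = contradiction refl n

  end-tgt : ∀ e → end (colour (tgt e)) e ≡ tgt e
  end-tgt e with colour (src e) Bool.≟ colour (tgt e)
  ... | yes eq = contradiction eq (proper e)
  ... | no _ = refl

  dart-unique : ∀ {k} d → colour (head G d) ≡ k → dart k (proj₁ d) ≡ d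
  dart-unique {k} (e , true) eq = cong (e ,_) (dec-true (colour (src e) Bool.≟ k) eq)
  dart-unique {k} (e , false) eq = cong (e ,_) (dec-false (colour (src e) Bool.≟ k) λ eq′ → proper e (trans eq′ (sym eq)))

  rev-dart : ∀ k e → rev G (dart k e) ≡ dart (not k) e
  rev-dart k e with colour (src e) Bool.≟ k | colour (src e) Bool.≟ not k
  ... | yes _ | no _ = refl
  ... | no _ | yes _ = refl
  ... | yes p | yes q = contradiction (trans (sym p) q) (Bool.not-¬ refl)
  ... | no p | no q = contradiction (Bool.¬-not p) q

  -- Every edge has exactly one end of each colour, so `ρ` yields one permutation of the edges per
  -- colour. The colour `true` is black.
  rot : Bool → Fin m → Fin m
  rot k e = proj₁ (ρ (dart k e))

  dart-rot : ∀ k e → dart k (rot k e) ≡ ρ (dart k e)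
  dart-rot k e = dart-unique (ρ (dart k e)) (trans (cong colour (ρ-local (dart k e))) (end-colour k e))

  end-rot : ∀ k e → end k (rot k e) ≡ end k e
  end-rot k e = trans (cong (head G) (dart-rot k e)) (ρ-local (dart k e))

  rot-injective : ∀ k {x y} → rot k x ≡ rot k y → x ≡ y
  rot-injective k {x} {y} eq = cong proj₁ (trans (sym (ρ⁻¹∘ρ (dart k x)))
    (trans (cong ρ⁻¹ (trans (sym (dart-rot k x)) (trans (cong (dart k) eq) (dart-rot k y)))) (ρ⁻¹∘ρ (dart k y))))

  -- `ρ-cyclic` as an induction principle: a property preserved by the rotation spreads from one
  -- edge to all edges at the same vertex.
  orbit : ∀ k {P : Fin m → Set} {x y} → (∀ {z} → P z → P (rot k z)) → P x → end k x ≡ end k y → P y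
  orbit k {P} {x} {y} next Px eq with ρ-cyclic (dart k x) (dart k y) eq
  ... | j , it = subst P (cong proj₁ it) (go j)
    where
    z : ℕ → Fin m
    z j = proj₁ (iter G ρ j (dart k x))
    dart-z : ∀ j → dart k (z j) ≡ iter G ρ j (dart k x)
    dart-z zero = refl
    dart-z (suc j) = trans (cong (dart k ∘ proj₁ ∘ ρ) (sym (dart-z j))) (trans (dart-rot k (z j)) (cong ρ (dart-z j)))
    go : ∀ j → P (z j)
    go zero = Px
    go (suc j) = subst P (cong (proj₁ ∘ ρ) (dart-z j)) (next (go j))

  at? : ∀ (F : EdgeSet G) v e → Dec (F e ≡ true × end (colour v) e ≡ v)
  at? F v e = (F e Bool.≟ true) ×-dec (end (colour v) e Fin.≟ v)

  star : EdgeSet G → Fin n → List (Fin m)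
  star F v = filter (at? F v) (allFin m)

  star-unique : ∀ F v → Unique (star F v)
  star-unique F v = Unique.filter⁺ (at? F v) (Unique.allFin⁺ m)

  ∈-star⁺ : ∀ F v {e} → F e ≡ true → end (colour v) e ≡ v → e ∈ star F v
  ∈-star⁺ F v {e} Fe eq = ∈-filter⁺ (at? F v) (∈-allFin e) (Fe , eq)

  ∈-star⁻ : ∀ F v {e} → e ∈ star F v → F e ≡ true × end (colour v) e ≡ v
  ∈-star⁻ F v e∈ = proj₂ (∈-filter⁻ (at? F v) {xs = allFin m} e∈)

  -- Only the end coloured like `v` can be `v`, so an edge contributes at most one to the degree.
  degree : ∀ F v → degIn G F v ≡ length (star F v)
  degree F v = go (allFin m)
    where
    one : Fin m → ℕ
    one e = if F e then ind G ⌊ src e Fin.≟ v ⌋ + ind G ⌊ tgt e Fin.≟ v ⌋ else 0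
    value : ∀ e → one e ≡ (if does (at? F v e) then 1 else 0)
    value e with F e
    ... | false = refl
    ... | true with colour (src e) Bool.≟ colour v
    ...   | yes eq with src e Fin.≟ v | tgt e Fin.≟ v
    ...     | yes p | yes q = contradiction (trans p (sym q)) (loopless e)
    ...     | yes p | no _ = refl
    ...     | no _ | yes q = contradiction (trans eq (cong colour (sym q))) (proper e)
    ...     | no _ | no _ = refl
    value e | true | no ≢c with src e Fin.≟ v | tgt e Fin.≟ v
    ...     | yes p | _ = contradiction (cong colour p) ≢c
    ...     | no _ | yes _ = refl
    ...     | no _ | no _ = refl
    go : ∀ es → sum (map one es) ≡ length (filter (at? F v) es)
    go [] = refl
    go (e ∷ es) rewrite value e with does (at? F v e)
    ... | true = cong suc (go es)
    ... | false = go es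

  -- A set of fewer than three edges closed under `τ` cannot exhaust the three edges at the vertex,
  -- which excludes orbits of size one and two. A longer orbit than three would put four distinct
  -- edges there.
  triad : ∀ k → Triad (allFin m) (rot k)
  triad k = record { closed = λ _ → ∈-allFin _ ; cube = λ {x} _ → At.cube x ; free = λ {x} _ → At.free x }
    where
    τ = rot k
    module At (x : Fin m) where
      v = end k x
      S = star (allEdges G) v
      S-size : length S ≡ 3
      S-size = trans (sym (degree (allEdges G) v)) (cubic v)
      end-v : ∀ {y} → y ∈ S → end k x ≡ end k y
      end-v {y} y∈ = trans (sym (proj₂ (∈-star⁻ (allEdges G) v y∈))) (cong (λ k → end k y) (end-colour k x))
      S∋ : ∀ {y} → end k y ≡ v → y ∈ S
      S∋ {y} eq = ∈-star⁺ (allEdges G) v refl (trans (cong (λ k → end k y) (end-colour k x)) eq)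
      not-covered : ∀ xs → length xs < 3 → x ∈ xs → (∀ {y} → y ∈ xs → τ y ∈ xs) → ⊥
      not-covered xs short x∈ next = ℕ.<⇒≱ short (subst (_≤ length xs) S-size
        (unique-⊆-length (star-unique (allEdges G) v) λ y∈ → orbit k {_∈ xs} next x∈ (end-v y∈)))
      free : τ x ≢ x
      free eq = not-covered (x ∷ []) (s≤s (s≤s z≤n)) (here refl) λ { (here refl) → here eq }
      free² : τ (τ x) ≢ x
      free² eq = not-covered (x ∷ τ x ∷ []) (s≤s (s≤s (s≤s z≤n))) (here refl) λ
        { (here refl) → there (here refl) ; (there (here refl)) → here eq }
      cube : τ (τ (τ x)) ≡ x
      cube with τ (τ (τ x)) ≟ᵉ x
      ... | yes eq = eq
      ... | no x₃≢x = contradiction (subst (4 ≤_) S-size (unique-⊆-length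
          {xs = τ (τ (τ x)) ∷ τ (τ x) ∷ τ x ∷ x ∷ []}
          (((free ∘ rot-injective k ∘ rot-injective k) ∷ (free² ∘ rot-injective k) ∷ x₃≢x ∷ []) ∷
           ((free ∘ rot-injective k) ∷ free² ∷ []) ∷ (free ∷ []) ∷ [] ∷ []) sub)) λ { (s≤s (s≤s (s≤s ()))) }
        where
        sub : ∀ {y} → y ∈ τ (τ (τ x)) ∷ τ (τ x) ∷ τ x ∷ x ∷ [] → y ∈ S
        sub (here refl) = S∋ (trans (end-rot k _) (trans (end-rot k _) (end-rot k x)))
        sub (there (here refl)) = S∋ (trans (end-rot k _) (end-rot k x))
        sub (there (there (here refl))) = S∋ (end-rot k x)
        sub (there (there (there (here refl)))) = S∋ refl

  β ω : Fin m → Fin m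
  β = rot true
  ω = rot false

  edge-at : ∀ v → ∃[ e ] (end (colour v) e ≡ v)
  edge-at v with star (allEdges G) v in eq | trans (sym (degree (allEdges G) v)) (cubic v)
  ... | e ∷ _ | _ = e , proj₂ (∈-star⁻ (allEdges G) v (subst (e ∈_) (sym eq) (here refl)))

  -- Vertices of one colour own disjoint triples of edges, so there are at most m/3 of each colour.
  -- In this direction the bound turns Euler's formula into a lower bound on the number of faces.
  three-n≤two-m : 3 * n ≤ m + m
  three-n≤two-m = begin
    3 * n                                        ≤⟨ ℕ.*-monoʳ-≤ 3 covered ⟩
    3 * (length (side true) + length (side false)) ≡⟨ ℕ.*-distribˡ-+ 3 (length (side true)) _ ⟩
    3 * length (side true) + 3 * length (side false) ≤⟨ ℕ.+-mono-≤ (bound true) (bound false) ⟩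
    m + m                                        ∎
    where
    open ℕ.≤-Reasoning
    side : Bool → List (Fin n)
    side k = filter (λ v → colour v Bool.≟ k) (allFin n)
    covered : n ≤ length (side true) + length (side false)
    covered = subst₂ _≤_ (length-tabulate {n = n} id) (length-++ (side true)) (unique-⊆-length (Unique.allFin⁺ n) λ {v} _ → in-side v)
      where
      in-side : ∀ v → v ∈ side true ++ side false
      in-side v with colour v in eq
      ... | true = ∈-++⁺ˡ (∈-filter⁺ (λ v → colour v Bool.≟ true) (∈-allFin v) eq)
      ... | false = ∈-++⁺ʳ (side true) (∈-filter⁺ (λ v → colour v Bool.≟ false) (∈-allFin v) eq)
    sum-const : (vs : List (Fin n)) → sum (map (λ _ → 3) vs) ≡ 3 * length vs
    sum-const [] = refl
    sum-const (_ ∷ vs) = trans (cong (3 +_) (sum-const vs)) (sym (ℕ.*-suc 3 (length vs)))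
    bound : ∀ k → 3 * length (side k) ≤ m
    bound k = subst₂ _≤_ (sum-const (side k)) (length-tabulate {n = m} id)
      (classes-length _≟ᵉ_ Fin._≟_ {allFin m} (end k) (Unique.allFin⁺ m) (λ _ → 3) (side k)
        (Unique.filter⁺ (λ v → colour v Bool.≟ k) (Unique.allFin⁺ n)) big)
      where
      big : ∀ {v} → v ∈ side k → 3 ≤ length (class _≟ᵉ_ Fin._≟_ {allFin m} (end k) v)
      big {v} v∈ with ∈-filter⁻ (λ v → colour v Bool.≟ k) {xs = allFin n} v∈
      ... | _ , refl = subst (_≤ length (class _≟ᵉ_ Fin._≟_ {allFin m} (end k) v)) (trans (sym (degree (allEdges G) v)) (cubic v))
        (unique-⊆-length (star-unique (allEdges G) v) λ {e} e∈ →
          ∈-filter⁺ (λ e → end k e Fin.≟ v) (∈-allFin e) (proj₂ (∈-star⁻ (allEdges G) v e∈)))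

  -- `φ` alternates between black and white darts, and `φ ∘ φ` acts on the black ones as `β ∘ ω`; a
  -- face is therefore recorded by its black darts.
  faceLabelling : ∀ {f} → Faces G rotation f → n + f ≡ m + 2 → FaceLabelling (Fin f) (allFin m) β ω
  faceLabelling {f} faces euler = record
    { label = face ∘ dart true
    ; invariant = λ {e} _ → trans (cong face (sym (double e))) (orb-face (dart true e) 2)
    ; names = allFin f ; unique = Unique.allFin⁺ f
    ; hit = λ {i} _ → hit (face-surj i)
    ; euler = subst₂ (λ a b → a + 6 ≤ 3 * b) (sym (length-tabulate {n = m} id)) (sym (length-tabulate {n = f} id)) bound }
    where
    open Faces faces
    open ℕ.≤-Reasoning
    φ-dart : ∀ k e → φ (dart k e) ≡ dart (not k) (rot (not k) e)
    φ-dart k e = trans (cong ρ (rev-dart k e)) (sym (dart-rot (not k) e))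
    double : ∀ e → φ (φ (dart true e)) ≡ dart true (β (ω e))
    double e = trans (cong φ (φ-dart true e)) (φ-dart false (ω e))
    hit : ∀ {i} → ∃[ d ] (face d ≡ i) → ∃[ e ] (e ∈ allFin m × face (dart true e) ≡ i)
    hit (d , eq) with colour (head G d) in c
    ... | true = proj₁ d , ∈-allFin _ , trans (cong face (dart-unique d c)) eq
    -- One step along its face takes a white dart to a black one.
    ... | false = β (proj₁ d) , ∈-allFin _ ,
      trans (cong face (trans (sym (φ-dart false (proj₁ d))) (cong φ (dart-unique d c)))) (trans (orb-face d 1) eq)
    bound : m + 6 ≤ 3 * f
    bound = ℕ.+-cancelˡ-≤ (m + m) _ _ (begin
      m + m + (m + 6)      ≡⟨ ℕ.+-assoc (m + m) m 6 ⟨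
      m + m + m + 6        ≡⟨ cong (_+ 6) (trans (ℕ.+-assoc m m m) (cong (λ z → m + (m + z)) (sym (ℕ.+-identityʳ m)))) ⟩
      3 * m + 3 * 2        ≡⟨ ℕ.*-distribˡ-+ 3 m 2 ⟨
      3 * (m + 2)          ≡⟨ cong (3 *_) euler ⟨
      3 * (n + f)          ≡⟨ ℕ.*-distribˡ-+ 3 n f ⟩
      3 * n + 3 * f        ≤⟨ ℕ.+-monoˡ-≤ (3 * f) three-n≤two-m ⟩
      m + m + 3 * f        ∎)

  rot-conn : ∀ k x → Conn (_∈ allFin m) β ω x (rot k x)
  rot-conn true x = β→ (∈-allFin _) (∈-allFin _) refl
  rot-conn false x = ω→ (∈-allFin _) (∈-allFin _) refl

  -- The edges `x` at `u` and `y` at `w` are arbitrary, so a walk may change edges at each vertex it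
  -- visits; `orbit` links the edges at one vertex.
  reach⇒conn : ∀ {u w} → ReachIn G (allEdges G) u w → ∀ {x y} → end (colour u) x ≡ u → end (colour w) y ≡ w →
               Conn (_∈ allFin m) β ω x y
  reach⇒conn {u} here {x} xu yu = orbit (colour u) {Conn (_∈ allFin m) β ω x} (λ c → c ◅◅ rot-conn (colour u) _) ε (trans xu (sym yu))
  reach⇒conn (fwd e _ refl p) xu yw = reach⇒conn here xu (end-src e) ◅◅ reach⇒conn p (end-tgt e) yw
  reach⇒conn (bwd e _ refl p) xu yw = reach⇒conn here xu (end-tgt e) ◅◅ reach⇒conn p (end-src e) yw

  planarMap : Connected G → ∀ {f} → Faces G rotation f → n + f ≡ m + 2 → PlanarMap (Fin f) (allFin m) β ω
  planarMap connected faces euler = record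
    { uL = Unique.allFin⁺ m ; Tβ = triad true ; Tω = triad false
    ; conn = λ {x} {y} _ _ → reach⇒conn (connected (src x) (src y)) (end-src x) (end-src y)
    ; faces = faceLabelling faces euler }

  -- Back from the map to 2-factors of the graph

  module _ (F : EdgeSet G) where

    reach-trans : ∀ {u v w} → ReachIn G F u v → ReachIn G F v w → ReachIn G F u w
    reach-trans here q = q
    reach-trans (fwd e Fe eq p) q = fwd e Fe eq (reach-trans p q)
    reach-trans (bwd e Fe eq p) q = bwd e Fe eq (reach-trans p q)

    reach-sym : ∀ {u v} → ReachIn G F u v → ReachIn G F v u
    reach-sym here = here
    reach-sym (fwd e Fe refl p) = reach-trans (reach-sym p) (bwd e Fe refl here)
    reach-sym (bwd e Fe refl p) = reach-trans (reach-sym p) (fwd e Fe refl here)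

    reach-end : ∀ k e → F e ≡ true → ReachIn G F (src e) (end k e)
    reach-end k e Fe with colour (src e) Bool.≟ k
    ... | yes _ = here
    ... | no _ = fwd e Fe refl here

    conn⇒reach : ∀ {x y} → Conn (In (allFin m) F) β ω x y → ReachIn G F (src x) (src y)
    conn⇒reach = EqC.fold {S = λ x y → ReachIn G F (src x) (src y)}
      (record { refl = here ; sym = reach-sym ; trans = reach-trans }) step
      where
      share : ∀ k {x} → F x ≡ true → F (rot k x) ≡ true → ReachIn G F (src x) (src (rot k x))
      share k {x} Fx Fy = reach-trans (reach-end k x Fx)
        (subst (λ v → ReachIn G F v (src (rot k x))) (end-rot k x) (reach-sym (reach-end k (rot k x) Fy)))
      step : ∀ {x y} → Step (In (allFin m) F) β ω x y → ReachIn G F (src x) (src y)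
      step (via-β (_ , Fx) (_ , Fy) refl) = share true Fx Fy
      step (via-ω (_ , Fx) (_ , Fy) refl) = share false Fx Fy

    -- By `orbit` the three edges of one rotation cycle are all the edges at `v`, and `OneFalse`
    -- leaves exactly two of them.
    twoFactor : (∀ k x → OneFalseAt (rot k) F x) → TwoFactor G F
    twoFactor one v = trans (degree F v) (trans (ℕ.≤-antisym
        (unique-⊆-length (star-unique F v) to) (unique-⊆-length uniq from)) two)
      where
      k = colour v
      x = proj₁ (edge-at v)
      xs = x ∷ rot k x ∷ rot k (rot k x) ∷ []
      open Triad (triad k)
      F? : ∀ y → Dec (F y ≡ true)
      F? y = F y Bool.≟ true
      uniq : Unique (filter F? xs)
      uniq = Unique.filter⁺ F? ((≢-sym (free (∈-allFin x)) ∷ ≢-sym (free² (∈-allFin x)) ∷ []) ∷ (≢-sym (free (∈-allFin _)) ∷ []) ∷ [] ∷ [])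
      two : length (filter F? xs) ≡ 2
      two = oneFalse-length F refl refl refl (one k x)
      to : ∀ {y} → y ∈ star F v → y ∈ filter F? xs
      to y∈ with ∈-star⁻ F v y∈
      ... | Fy , eq = ∈-filter⁺ F? (orbit k {_∈ xs} (cycle₃-closed (triad-cycle (triad k) (∈-allFin x))) (here refl)
                        (trans (proj₂ (edge-at v)) (sym eq))) Fy
      ends : ∀ {y} → y ∈ xs → end k y ≡ v
      ends (here refl) = proj₂ (edge-at v)
      ends (there (here refl)) = trans (end-rot k _) (proj₂ (edge-at v))
      ends (there (there (here refl))) = trans (end-rot k _) (trans (end-rot k _) (proj₂ (edge-at v)))
      from : ∀ {y} → y ∈ filter F? xs → y ∈ star F v
      from y∈ with ∈-filter⁻ F? {xs = xs} y∈
      ... | y∈xs , Fy = ∈-star⁺ F v Fy (ends y∈xs)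

theorem8 : (G : Multigraph) → Connected G → Planar G → Cubic G → Bipartite G →
    (e₁ e₂ : Fin (Multigraph.m G)) →
    Σ (EdgeSet G) λ F → TwoFactor G F × SameCycle G F e₁ e₂
theorem8 G connected (rotation , _ , faces , euler) cubic bipartite e₁ e₂ =
  F , twoFactor F (λ { true x → atβ (∈-allFin x) ; false x → atω (∈-allFin x) }) , s∈F , t∈F , conn⇒reach F path
  where
  open Translate G cubic bipartite rotation
  open Solution (solve Fin._≟_ Fin._≟_ _ ℕ.≤-refl (planarMap connected faces euler) (∈-allFin e₁) (∈-allFin e₂))
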